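{- Let $\mathbb{K}$ be a field of characteristic zero and let $G$ be any graph (loopless, multiple edges allowed) on the vertex set $\{0,1,\dots,n\}$. Then the four $\mathbb{K}$-algebras $\mathcal{B}_G$, $\mathcal{C}_G$, $\mathcal{D}_G$ and $\mathcal{K}_G$ defined below are pairwise isomorphic as (non-filtered) algebras.
   Context: Graphs have finitely many edges, no loops, and may have multiple edges. $\Phi_G$ is the commutative $\mathbb{K}$-algebra generated by variables $\phi_e$, one for each edge $e$ of $G$, with defining relations $\phi_e^2=0$ for every edge $e$. For a vertex $i$ and an edge $e$ put $c_{i,e}=1$ if $e$ joins $i$ to a vertex $j$ with $i<j$, $c_{i,e}=-1$ if $e$ joins $i$ to a vertex $j$ with $i>j$, and $c_{i,e}=0$ if $e$ is not incident to $i$. Put $X_i=\sum_{e} c_{i,e}\phi_e\in\Phi_G$ for $i=0,\dots,n$. $\mathcal{C}_G$ is the subalgebra of $\Phi_G$ generated by $X_1,\dots,X_n$. Put $Y_i=\exp(X_i)=\prod_{e}(1+c_{i,e}\phi_e)$ for $i=0,\dots,n$; $\mathcal{K}_G$ is the subalgebra of $\Phi_G$ generated by $1,Y_0,\dots,Y_n$. For a set $I$ of vertices, $D_I$ denotes the number of edges of $G$ with exactly one endpoint in $I$. $\mathcal{J}_G\subset\mathbb{K}[x_1,\dots,x_n]$ is the ideal generated by $\left(\sum_{i\in I}x_i\right)^{D_I+1}$ for all nonempty $I\subseteq\{1,\dots,n\}$, and $\mathcal{B}_G=\mathbb{K}[x_1,\dots,x_n]/\mathcal{J}_G$. $\mathcal{I}_G\subset\mathbb{K}[y_0,\dots,y_n]$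 is the ideal generated by $\left(\prod_{i\in I}y_i-1\right)^{D_I+1}$ for all nonempty $I\subseteq\{0,1,\dots,n\}$, and $\mathcal{D}_G=\mathbb{K}[y_0,\dots,y_n]/\mathcal{I}_G$. -}

module Defs where

open import Level using (Level; _⊔_) renaming (suc to lsuc)
open import Algebra.Bundles using (CommutativeRing)
open import Data.Nat as ℕ using (ℕ; zero; suc)
open import Data.Fin as Fin using (Fin; zero; suc; _≟_)
open import Data.Fin.Subset using (Subset; Nonempty)
open import Data.Vec using (lookup; _∷_)
open import Data.Bool using (Bool; true; false; if_then_else_; _xor_)
open import Data.Product using (Σ; _,_)
open import Relation.Nullary using (¬_; does)

record Graph (n : ℕ) : Set where
  field
    m       : ℕ
    src tgt : Fin m → Fin (suc n)
    src<tgt : ∀ e → src e Fin.< tgt e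

module _ {c ℓ : Level} (K : CommutativeRing c ℓ) where
  open CommutativeRing K using (Carrier; _≈_; _+_; _*_; 0#; 1#)

  natK : ℕ → Carrier
  natK zero    = 0#
  natK (suc k) = 1# + natK k

  record IsFieldOfChar0 : Set (c ⊔ ℓ) where
    field
      1≉0   : ¬ (1# ≈ 0#)
      inv   : ∀ x → ¬ (x ≈ 0#) → Σ Carrier λ y → x * y ≈ 1#
      char0 : ∀ k → ¬ (natK (suc k) ≈ 0#)

module Algebras {c ℓ : Level} (K : CommutativeRing c ℓ) where
  open CommutativeRing K using (Carrier; _≈_; _+_; _*_; -_; 0#; 1#)

  record KAlgebra (a ℓa : Level) : Set (c ⊔ lsuc (a ⊔ ℓa)) where
    field
      A    : Set a
      _≈A_ : A → A → Set ℓa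
      _+A_ : A → A → A
      _*A_ : A → A → A
      -A_  : A → A
      ι    : Carrier → A

  record _≅_ {a ℓa b ℓb : Level} (P : KAlgebra a ℓa) (Q : KAlgebra b ℓb)
             : Set (c ⊔ a ⊔ ℓa ⊔ b ⊔ ℓb) where
    open KAlgebra P renaming (A to P₀; _≈A_ to _≈P_; _+A_ to _+P_; _*A_ to _*P_; ι to ιP)
    open KAlgebra Q renaming (A to Q₀; _≈A_ to _≈Q_; _+A_ to _+Q_; _*A_ to _*Q_; ι to ιQ)
    field
      to       : P₀ → Q₀
      from     : Q₀ → P₀
      to-cong  : ∀ {x y} → x ≈P y → to x ≈Q to y
      from-cong : ∀ {x y} → x ≈Q y → from x ≈P from y
      to-+     : ∀ x y → to (x +P y) ≈Q (to x +Q to y)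
      to-*     : ∀ x y → to (x *P y) ≈Q (to x *Q to y)
      to-ι     : ∀ k → to (ιP k) ≈Q ιQ k     -- K-linear, unital
      to∘from  : ∀ y → to (from y) ≈Q y
      from∘to  : ∀ x → from (to x) ≈P x

  data Term (V : Set) : Set c where
    var  : V → Term V
    con  : Carrier → Term V
    _⊕_  : Term V → Term V → Term V
    _⊗_  : Term V → Term V → Term V
    ⊝_   : Term V → Term V

  infixl 6 _⊕_
  infixl 7 _⊗_

  module _ {V : Set} where
    _⊖_ : Term V → Term V → Term V
    a ⊖ b = a ⊕ (⊝ b)

    𝟙 𝟘 : Term V
    𝟙 = con 1#
    𝟘 = con 0#

    _^_ : Term V → ℕ → Term V
    t ^ zero  = 𝟙
    t ^ suc k = t ⊗ (t ^ k)

    ⨁ : ∀ {k} → (Fin k → Term V) → Term V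
    ⨁ {zero}  f = 𝟘
    ⨁ {suc k} f = f zero ⊕ ⨁ (λ i → f (suc i))

    ⨂ : ∀ {k} → (Fin k → Term V) → Term V
    ⨂ {zero}  f = 𝟙
    ⨂ {suc k} f = f zero ⊗ ⨂ (λ i → f (suc i))

  _[_] : ∀ {U W : Set} → Term U → (U → Term W) → Term W
  var u   [ g ] = g u
  con k   [ g ] = con k
  (a ⊕ b) [ g ] = (a [ g ]) ⊕ (b [ g ])
  (a ⊗ b) [ g ] = (a [ g ]) ⊗ (b [ g ])
  (⊝ a)   [ g ] = ⊝ (a [ g ])

  -- The commutative K-algebra K[V]/(rel r : r ∈ R) presented by
  -- generators V and relations rel : R → Term V.  Its equality is the
  -- least congruence containing the commutative-ring axioms, the
  -- K-algebra structure of the scalars, and rel r ≈ 0.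

  module Presentation {V R : Set} (rel : R → Term V) where
    infix 4 _≋_
    data _≋_ : Term V → Term V → Set (c ⊔ ℓ) where
      ≋-refl  : ∀ {a} → a ≋ a
      ≋-sym   : ∀ {a b} → a ≋ b → b ≋ a
      ≋-trans : ∀ {a b d} → a ≋ b → b ≋ d → a ≋ d
      ⊕-cong  : ∀ {a a' b b'} → a ≋ a' → b ≋ b' → a ⊕ b ≋ a' ⊕ b'
      ⊗-cong  : ∀ {a a' b b'} → a ≋ a' → b ≋ b' → a ⊗ b ≋ a' ⊗ b'
      ⊝-cong  : ∀ {a a'} → a ≋ a' → ⊝ a ≋ ⊝ a'
      con-cong : ∀ {k l} → k ≈ l → con k ≋ con l
      con-+   : ∀ k l → con (k + l) ≋ con k ⊕ con l
      con-*   : ∀ k l → con (k * l) ≋ con k ⊗ con l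
      ⊕-assoc : ∀ a b d → (a ⊕ b) ⊕ d ≋ a ⊕ (b ⊕ d)
      ⊕-comm  : ∀ a b → a ⊕ b ≋ b ⊕ a
      ⊕-idˡ   : ∀ a → 𝟘 ⊕ a ≋ a
      ⊝-invˡ  : ∀ a → (⊝ a) ⊕ a ≋ 𝟘
      ⊗-assoc : ∀ a b d → (a ⊗ b) ⊗ d ≋ a ⊗ (b ⊗ d)
      ⊗-comm  : ∀ a b → a ⊗ b ≋ b ⊗ a
      ⊗-idˡ   : ∀ a → 𝟙 ⊗ a ≋ a
      distribˡ : ∀ a b d → a ⊗ (b ⊕ d) ≋ (a ⊗ b) ⊕ (a ⊗ d)
      relation : ∀ r → rel r ≋ 𝟘

    algebra : KAlgebra c (c ⊔ ℓ)
    algebra = record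
      { A = Term V ; _≈A_ = _≋_ ; _+A_ = _⊕_ ; _*A_ = _⊗_ ; -A_ = ⊝_ ; ι = con }

    record Sub {U : Set} (gen : U → Term V) : Set (c ⊔ ℓ) where
      constructor sub
      field
        elt     : Term V
        expr    : Term U
        witness : (expr [ gen ]) ≋ elt

    subalgebra : {U : Set} → (U → Term V) → KAlgebra (c ⊔ ℓ) (c ⊔ ℓ)
    subalgebra {U} gen = record
      { A = Sub gen
      ; _≈A_ = λ x y → Sub.elt x ≋ Sub.elt y
      ; _+A_ = λ { (sub a s p) (sub b t q) → sub (a ⊕ b) (s ⊕ t) (⊕-cong p q) }
      ; _*A_ = λ { (sub a s p) (sub b t q) → sub (a ⊗ b) (s ⊗ t) (⊗-cong p q) }
      ; -A_  = λ { (sub a s p) → sub (⊝ a) (⊝ s) (⊝-cong p) }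
      ; ι    = λ k → sub (con k) (con k) ≋-refl
      }

  module _ {n : ℕ} (G : Graph n) where
    open Graph G

    countEdges : ∀ {k} → (Fin k → Bool) → ℕ
    countEdges {zero}  p = zero
    countEdges {suc k} p = (if p zero then 1 else 0) ℕ.+ countEdges (λ e → p (suc e))

    D : Subset (suc n) → ℕ
    D I = countEdges (λ e → lookup I (src e) xor lookup I (tgt e))

    coeff : Fin (suc n) → Fin m → Carrier
    coeff i e = if does (i ≟ src e) then 1#
                else (if does (i ≟ tgt e) then - 1# else 0#)

    module Φ = Presentation {Fin m} {Fin m} (λ e → var e ⊗ var e)

    Φ-G : KAlgebra c (c ⊔ ℓ)
    Φ-G = Φ.algebra

    X : Fin (suc n) → Term (Fin m)
    X i = ⨁ (λ e → con (coeff i e) ⊗ var e)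

    Y : Fin (suc n) → Term (Fin m)
    Y i = ⨂ (λ e → 𝟙 ⊕ (con (coeff i e) ⊗ var e))

    C-G : KAlgebra (c ⊔ ℓ) (c ⊔ ℓ)
    C-G = Φ.subalgebra {Fin n} (λ i → X (suc i))

    -- K_G : generated by 1, Y_0,...,Y_n  (1 is in every subalgebra)
    K-G : KAlgebra (c ⊔ ℓ) (c ⊔ ℓ)
    K-G = Φ.subalgebra {Fin (suc n)} Y

    -- B_G = K[x_1..x_n] / J_G ; variable i : Fin n is x_{i+1}
    -- (vertex suc i); I ⊆ {1..n} is the vertex set false ∷ I.
    B-rel : Σ (Subset n) Nonempty → Term (Fin n)
    B-rel (I , _) =
      ⨁ (λ i → if lookup I i then var i else 𝟘) ^ suc (D (false ∷ I))

    B-G : KAlgebra c (c ⊔ ℓ)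
    B-G = Presentation.algebra B-rel

    D-rel : Σ (Subset (suc n)) Nonempty → Term (Fin (suc n))
    D-rel (I , _) =
      (⨂ (λ i → if lookup I i then var i else 𝟙) ⊖ 𝟙) ^ suc (D I)

    D-G : KAlgebra c (c ⊔ ℓ)
    D-G = Presentation.algebra D-rel

{-# OPTIONS --safe #-}
module Submission where

-- Everything rests on the kernel of x_i ↦ X_i being generated by the powers (Σ_{i∈I} x_i)^(D_I+1).
-- This is an induction on the edges. Let e = (a,b) be an edge, φ its variable, ∂ = ∂/∂x_a - ∂/∂x_b.
-- Then p(X) = p(X′) + φ (∂p)(X′), where X′ belongs to the deletion G - e. So p(X) = 0 puts ∂p in the
-- ideal of G - e, and in characteristic zero integration along ∂ carries that ideal into the
-- ideal of G: there is j in the latter with ∂j = ∂p. The remainder p - j is killed by ∂, hence is a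
-- polynomial in the variables of the contraction G / e, where the induction hypothesis applies to it;
-- and the ideal of G / e maps into the ideal of G.
-- For the multiplicative algebras, Y_i = exp X_i. All elements concerned are nilpotent, so truncated
-- exponentials and logarithms are polynomial, and they translate x_i into y_i and back.

-- The exponents make the induction fit: integration along ∂ raises an exponent by one exactly for
-- those I whose cut contains e, and these are the I for which D_I drops by one in the deletion. For
-- all other I the form is a constant of ∂ and only its coefficient has to be integrated.
-- Contraction creates loops and merges vertices, so the induction runs over graphs with loops on a
-- fixed vertex set, in a symmetric presentation with one variable per vertex and one relation for
-- every vertex set. The variable x_0 is eliminated only afterwards. Since ∂ does not preserve the
-- ideals, it acts on the polynomial ring, and vanishing in a quotient is first rewritten as an
-- explicit combination of generators. On the multiplicative side a crude nilpotency bound is not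
-- enough, because the exponents D_I + 1 have to match. They do because a nilpotent x and exp x - 1
-- are multiples of each other: x^d = 0 and (exp x - 1)^d = 0 are equivalent for the same d.

open import Defs
open import Level using (Level; _⊔_)
open import Algebra.Bundles using (CommutativeRing; RawRing)
import Algebra.Properties.AbelianGroup
import Algebra.Properties.CommutativeSemigroup
import Algebra.Properties.Ring
import Algebra.Properties.Semiring.Mult.TCOptimised
import Algebra.Properties.Semiring.Sum
import Algebra.Solver.Ring
open import Algebra.Solver.Ring.AlmostCommutativeRing using (fromCommutativeRing; _-Raw-AlmostCommutative⟶_)
open import Data.Bool using (Bool; true; false; if_then_else_; _xor_; not)
open import Data.Bool.Properties using (xor-same)
open import Data.Empty using (⊥)
open import Data.Fin using (Fin; zero; suc; _≟_)
open import Data.Fin.Properties using (<⇒≢)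
open import Data.Fin.Subset using (Nonempty)
open import Data.Fin.Subset.Properties using (nonempty?)
open import Data.Maybe.Base using (Maybe; just; nothing)
open import Data.Nat using (ℕ; zero; suc)
import Data.Nat as ℕ
import Data.Nat.Properties as ℕ
open import Data.Product using (_×_; _,_; proj₁; proj₂; ∃)
open import Data.Product.Properties using (≡-dec)
open import Data.Unit using (tt)
open import Data.Vec using (lookup; tabulate; _∷_)
open import Data.Vec.Properties using (lookup∘tabulate; lookup⇒[]=)
open import Relation.Binary.PropositionalEquality using (_≡_; _≢_)
import Relation.Binary.PropositionalEquality as ≡
import Relation.Binary.Reasoning.Setoid
open import Relation.Nullary using (¬_; yes; no; does; contradiction)
open import Relation.Nullary.Decidable using (dec-true; dec-false)

-- The coefficients are formal differences of natural numbers, kept in lowest terms; without a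
-- decidable equality of coefficients the ring solver could not cancel x - x.
module DifferenceSolver {a ℓ : Level} (R : CommutativeRing a ℓ) where
  open CommutativeRing R hiding (zero)
  open Algebra.Properties.AbelianGroup +-abelianGroup using (⁻¹-∙-comm; ⁻¹-anti-homo‿-; ε⁻¹≈ε)
  open Algebra.Properties.Semiring.Mult.TCOptimised semiring using (×-homo-+; ×1-homo-*) renaming (_×_ to _·_)
  open Algebra.Properties.CommutativeSemigroup +-commutativeSemigroup using (interchange)
  open Algebra.Properties.Ring ring using ([y-z]x≈yx-zx; x[y-z]≈xy-xz)
  open Relation.Binary.Reasoning.Setoid setoid

  reduce : ℕ → ℕ → ℕ × ℕ
  reduce (suc p) (suc q) = reduce p q
  reduce p       q       = p , q

  differences : RawRing _ _
  differences = record
    { Carrier = ℕ × ℕ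
    ; _≈_     = _≡_
    ; _+_     = λ (p , q) (r , s) → reduce (p ℕ.+ r) (q ℕ.+ s)
    ; _*_     = λ (p , q) (r , s) → reduce (p ℕ.* r ℕ.+ q ℕ.* s) (p ℕ.* s ℕ.+ q ℕ.* r)
    ; -_      = λ (p , q) → q , p
    ; 0#      = 0 , 0
    ; 1#      = 1 , 0
    }

  -- Separate clauses make (0 , 0) and (1 , 0) denote 0# and 1# on the nose.
  ⟪_⟫ : ℕ × ℕ → Carrier
  ⟪ p , zero ⟫  = p · 1#
  ⟪ p , suc q ⟫ = p · 1# - suc q · 1#

  ⟪⟫-difference : ∀ p q → ⟪ p , q ⟫ ≈ p · 1# - q · 1#
  ⟪⟫-difference p zero    = sym (trans (+-congˡ ε⁻¹≈ε) (+-identityʳ _))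
  ⟪⟫-difference p (suc q) = refl

  difference-+ : ∀ w x y z → (w + y) - (x + z) ≈ (w - x) + (y - z)
  difference-+ w x y z = trans (+-congˡ (sym (⁻¹-∙-comm x z))) (interchange w y (- x) (- z))

  ⟪⟫-reduce : ∀ p q → ⟪ reduce p q ⟫ ≈ p · 1# - q · 1#
  ⟪⟫-reduce (suc p) (suc q) = begin
    ⟪ reduce p q ⟫                    ≈⟨ ⟪⟫-reduce p q ⟩
    p · 1# - q · 1#                   ≈⟨ +-identityˡ _ ⟨
    0# + (p · 1# - q · 1#)            ≈⟨ +-congʳ (-‿inverseʳ 1#) ⟨
    (1# - 1#) + (p · 1# - q · 1#)     ≈⟨ difference-+ _ _ _ _ ⟨
    (1# + p · 1#) - (1# + q · 1#)     ≈⟨ +-cong (×-homo-+ 1# 1 p) (-‿cong (×-homo-+ 1# 1 q)) ⟨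
    suc p · 1# - suc q · 1#           ∎
  ⟪⟫-reduce (suc p) zero    = ⟪⟫-difference (suc p) zero
  ⟪⟫-reduce zero    zero    = ⟪⟫-difference zero zero
  ⟪⟫-reduce zero    (suc q) = ⟪⟫-difference zero (suc q)

  ⟪⟫-+ : ∀ u v → ⟪ RawRing._+_ differences u v ⟫ ≈ ⟪ u ⟫ + ⟪ v ⟫
  ⟪⟫-+ (p , q) (r , s) = begin
    ⟪ reduce (p ℕ.+ r) (q ℕ.+ s) ⟫               ≈⟨ ⟪⟫-reduce (p ℕ.+ r) (q ℕ.+ s) ⟩
    (p ℕ.+ r) · 1# - (q ℕ.+ s) · 1#              ≈⟨ +-cong (×-homo-+ 1# p r) (-‿cong (×-homo-+ 1# q s)) ⟩
    (p · 1# + r · 1#) - (q · 1# + s · 1#)        ≈⟨ difference-+ _ _ _ _ ⟩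
    (p · 1# - q · 1#) + (r · 1# - s · 1#)        ≈⟨ +-cong (⟪⟫-difference p q) (⟪⟫-difference r s) ⟨
    ⟪ p , q ⟫ + ⟪ r , s ⟫                        ∎

  ⟪⟫-* : ∀ u v → ⟪ RawRing._*_ differences u v ⟫ ≈ ⟪ u ⟫ * ⟪ v ⟫
  ⟪⟫-* (p , q) (r , s) = begin
    ⟪ reduce (p ℕ.* r ℕ.+ q ℕ.* s) (p ℕ.* s ℕ.+ q ℕ.* r) ⟫
      ≈⟨ ⟪⟫-reduce (p ℕ.* r ℕ.+ q ℕ.* s) (p ℕ.* s ℕ.+ q ℕ.* r) ⟩
    (p ℕ.* r ℕ.+ q ℕ.* s) · 1# - (p ℕ.* s ℕ.+ q ℕ.* r) · 1#
      ≈⟨ +-cong (sum-of-products p r q s) (-‿cong (sum-of-products p s q r)) ⟩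
    (P * T + Q * S) - (P * S + Q * T)            ≈⟨ difference-+ _ _ _ _ ⟩
    (P * T - P * S) + (Q * S - Q * T)            ≈⟨ +-congˡ (⁻¹-anti-homo‿- _ _) ⟨
    (P * T - P * S) - (Q * T - Q * S)            ≈⟨ +-cong (x[y-z]≈xy-xz P T S) (-‿cong (x[y-z]≈xy-xz Q T S)) ⟨
    P * (T - S) - Q * (T - S)                    ≈⟨ [y-z]x≈yx-zx (T - S) P Q ⟨
    (P - Q) * (T - S)                            ≈⟨ *-cong (⟪⟫-difference p q) (⟪⟫-difference r s) ⟨
    ⟪ p , q ⟫ * ⟪ r , s ⟫                        ∎
    where
    P = p · 1#
    Q = q · 1#
    T = r · 1#
    S = s · 1#
    sum-of-products : ∀ i j k l → (i ℕ.* j ℕ.+ k ℕ.* l) · 1# ≈ (i · 1#) * (j · 1#) + (k · 1#) * (l · 1#)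
    sum-of-products i j k l = trans (×-homo-+ 1# (i ℕ.* j) (k ℕ.* l)) (+-cong (×1-homo-* i j) (×1-homo-* k l))

  ⟪⟫-neg : ∀ u → ⟪ RawRing.-_ differences u ⟫ ≈ - ⟪ u ⟫
  ⟪⟫-neg (p , q) = trans (⟪⟫-difference q p) (trans (sym (⁻¹-anti-homo‿- _ _)) (-‿cong (sym (⟪⟫-difference p q))))

  morphism : differences -Raw-AlmostCommutative⟶ fromCommutativeRing R
  morphism = record
    { ⟦_⟧ = ⟪_⟫ ; +-homo = ⟪⟫-+ ; *-homo = ⟪⟫-* ; -‿homo = ⟪⟫-neg ; 0-homo = refl ; 1-homo = refl }

  _≟ᵈ_ : ∀ u v → Maybe (⟪ u ⟫ ≈ ⟪ v ⟫)
  u ≟ᵈ v with ≡-dec ℕ._≟_ ℕ._≟_ u v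
  ... | yes eq = just (reflexive (≡.cong ⟪_⟫ eq))
  ... | no  _  = nothing

  open Algebra.Solver.Ring differences (fromCommutativeRing R) morphism _≟ᵈ_ public
    using (solve; _:=_; _:+_; _:*_; _:-_; :-_; Polynomial)
  open Algebra.Solver.Ring differences (fromCommutativeRing R) morphism _≟ᵈ_
    using (con)

  :0 :1 : ∀ {n} → Polynomial n
  :0 = con (0 , 0)
  :1 = con (1 , 0)

module Isomorphisms {c ℓ : Level} (K : CommutativeRing c ℓ) (isField : IsFieldOfChar0 K) where
  open CommutativeRing K using (Carrier; _≈_; _+_; _*_; -_; 0#; 1#)
  open Algebras K

  module 𝕂 = CommutativeRing K

  private variable
    U V W : Set

  -- Ring identities in the ground field

  module Scalars where
    open DifferenceSolver K

    u≈[1+0]u : ∀ u → u ≈ (1# + 0#) * u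
    u≈[1+0]u = solve 1 (λ u → u := (:1 :+ :0) :* u) 𝕂.refl

    u+nu≈[1+n]u : ∀ u n → u + n * u ≈ (1# + n) * u
    u+nu≈[1+n]u = solve 2 (λ u n → u :+ n :* u := (:1 :+ n) :* u) 𝕂.refl

    [ab][cd]≈[da][cb] : ∀ a b c d → (a * b) * (c * d) ≈ (d * a) * (c * b)
    [ab][cd]≈[da][cb] = solve 4 (λ a b c d → (a :* b) :* (c :* d) := (d :* a) :* (c :* b)) 𝕂.refl

    1-0≈1 : 1# + - 0# ≈ 1#
    1-0≈1 = solve 0 (:1 :- :0 := :1) 𝕂.refl

    0-1≈-1 : 0# + - 1# ≈ - 1#
    0-1≈-1 = solve 0 (:0 :- :1 := :- :1) 𝕂.refl

    [1-0]1≈1 : (1# + - 0#) * 1# ≈ 1#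
    [1-0]1≈1 = solve 0 ((:1 :- :0) :* :1 := :1) 𝕂.refl

    [0-1][-1]≈1 : (0# + - 1#) * - 1# ≈ 1#
    [0-1][-1]≈1 = solve 0 ((:0 :- :1) :* (:- :1) := :1) 𝕂.refl

    x≈y+[x-y]1 : ∀ x y → x ≈ y + (x + - y) * 1#
    x≈y+[x-y]1 = solve 2 (λ x y → x := y :+ (x :- y) :* :1) 𝕂.refl

    x≈x+y0 : ∀ x y → x ≈ x + y * 0#
    x≈x+y0 = solve 2 (λ x y → x := x :+ y :* :0) 𝕂.refl

    0≈1+[-1]1 : 0# ≈ 1# + - 1# * 1#
    0≈1+[-1]1 = solve 0 (:0 := :1 :+ (:- :1) :* :1) 𝕂.refl

    f[x-y]≈fx-fy : ∀ f x y → f * (x + - y) ≈ f * x + - (f * y)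
    f[x-y]≈fx-fy = solve 3 (λ f x y → f :* (x :- y) := f :* x :- f :* y) 𝕂.refl

    0≈-0 : 0# ≈ - 0#
    0≈-0 = solve 0 (:0 := :- :0) 𝕂.refl

    -x-y≈-[x+y] : ∀ x y → - x + - y ≈ - (x + y)
    -x-y≈-[x+y] = solve 2 (λ x y → :- x :+ :- y := :- (x :+ y)) 𝕂.refl

  open Scalars

  -- Presented algebras as commutative rings

  module Alg {V R : Set} (rel : R → Term V) where
    open Presentation rel public

    ring : CommutativeRing c (c ⊔ ℓ)
    ring = record
      { Carrier = Term V ; _≈_ = _≋_ ; _+_ = _⊕_ ; _*_ = _⊗_ ; -_ = ⊝_ ; 0# = 𝟘 ; 1# = 𝟙
      ; isCommutativeRing = record
        { isRing = record
          { +-isAbelianGroup = record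
            { isGroup = record
              { isMonoid = record
                { isSemigroup = record
                  { isMagma = record
                    { isEquivalence = record { refl = ≋-refl ; sym = ≋-sym ; trans = ≋-trans }
                    ; ∙-cong = ⊕-cong }
                  ; assoc = ⊕-assoc }
                ; identity = ⊕-idˡ , λ a → ≋-trans (⊕-comm a 𝟘) (⊕-idˡ a) }
              ; inverse = ⊝-invˡ , λ a → ≋-trans (⊕-comm a (⊝ a)) (⊝-invˡ a)
              ; ⁻¹-cong = ⊝-cong }
            ; comm = ⊕-comm }
          ; *-cong = ⊗-cong
          ; *-assoc = ⊗-assoc
          ; *-identity = ⊗-idˡ , λ a → ≋-trans (⊗-comm a 𝟙) (⊗-idˡ a)
          ; distrib = distribˡ , λ a b d → ≋-trans (⊗-comm (b ⊕ d) a)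
              (≋-trans (distribˡ a b d) (⊕-cong (⊗-comm a b) (⊗-comm a d)))
          }
        ; *-comm = ⊗-comm
        }
      }

    open CommutativeRing ring public using (setoid)
      renaming ( +-congˡ to ⊕-congˡ; +-congʳ to ⊕-congʳ; *-congˡ to ⊗-congˡ; *-congʳ to ⊗-congʳ
               ; +-identityʳ to ⊕-idʳ; *-identityʳ to ⊗-idʳ; zeroˡ to ⊗-zeroˡ; zeroʳ to ⊗-zeroʳ
               ; -‿inverseʳ to ⊝-invʳ; reflexive to ≋-reflexive)
    open DifferenceSolver ring public

    ⊖≋𝟘⇒≋ : ∀ {a b} → a ⊖ b ≋ 𝟘 → a ≋ b
    ⊖≋𝟘⇒≋ {a} {b} p = ≋-trans (solve 2 (λ a b → a := (a :- b) :+ b) ≋-refl a b)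
                       (≋-trans (⊕-congʳ p) (⊕-idˡ b))

    ≋⇒⊖≋𝟘 : ∀ {a b} → a ≋ b → a ⊖ b ≋ 𝟘
    ≋⇒⊖≋𝟘 {b = b} p = ≋-trans (⊕-congʳ p) (⊝-invʳ b)

    ≋𝟘⇒⊗≋𝟘 : ∀ {a} b → a ≋ 𝟘 → a ⊗ b ≋ 𝟘
    ≋𝟘⇒⊗≋𝟘 b p = ≋-trans (⊗-congʳ p) (⊗-zeroˡ b)

    ≋𝟘⇒⊗≋𝟘ʳ : ∀ a {b} → b ≋ 𝟘 → a ⊗ b ≋ 𝟘
    ≋𝟘⇒⊗≋𝟘ʳ a p = ≋-trans (⊗-congˡ p) (⊗-zeroʳ a)

    ⊕≋𝟘 : ∀ {a b} → a ≋ 𝟘 → b ≋ 𝟘 → a ⊕ b ≋ 𝟘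
    ⊕≋𝟘 p q = ≋-trans (⊕-cong p q) (⊕-idˡ 𝟘)

    ⊝≋𝟘 : ∀ {a} → a ≋ 𝟘 → ⊝ a ≋ 𝟘
    ⊝≋𝟘 p = ≋-trans (⊝-cong p) (solve 0 (:- :0 := :0) ≋-refl)

    ⨁-cong : ∀ {k} {f g : Fin k → Term V} → (∀ i → f i ≋ g i) → ⨁ f ≋ ⨁ g
    ⨁-cong {zero}  h = ≋-refl
    ⨁-cong {suc k} h = ⊕-cong (h zero) (⨁-cong (λ i → h (suc i)))

    ⨂-cong : ∀ {k} {f g : Fin k → Term V} → (∀ i → f i ≋ g i) → ⨂ f ≋ ⨂ g
    ⨂-cong {zero}  h = ≋-refl
    ⨂-cong {suc k} h = ⊗-cong (h zero) (⨂-cong (λ i → h (suc i)))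

    ^-cong : ∀ {a b} n → a ≋ b → a ^ n ≋ b ^ n
    ^-cong zero    p = ≋-refl
    ^-cong (suc n) p = ⊗-cong p (^-cong n p)

    ^-distrib-⊗ : ∀ a b n → (a ⊗ b) ^ n ≋ a ^ n ⊗ b ^ n
    ^-distrib-⊗ a b zero    = ≋-sym (⊗-idˡ 𝟙)
    ^-distrib-⊗ a b (suc n) = ≋-trans (⊗-congˡ (^-distrib-⊗ a b n))
      (solve 4 (λ a b x y → (a :* b) :* (x :* y) := (a :* x) :* (b :* y)) ≋-refl a b (a ^ n) (b ^ n))

    ^-+ : ∀ a m n → a ^ (m ℕ.+ n) ≋ a ^ m ⊗ a ^ n
    ^-+ a zero    n = ≋-sym (⊗-idˡ _)
    ^-+ a (suc m) n = ≋-trans (⊗-congˡ (^-+ a m n)) (≋-sym (⊗-assoc _ _ _))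

    ^-vanishes-above : ∀ {a m n} → m ℕ.≤ n → a ^ m ≋ 𝟘 → a ^ n ≋ 𝟘
    ^-vanishes-above {a} {m} m≤n p with ℕ.m≤n⇒∃[o]m+o≡n m≤n
    ... | o , ≡.refl = ≋-trans (^-+ a m o) (≋𝟘⇒⊗≋𝟘 (a ^ o) p)

    -- This transports exponents without loss: `exp N x ⊖ 𝟙` is a multiple of `x`, and `log N k z`
    -- is a multiple of `z`.
    ^-vanishes-⊗ : ∀ {a b x} n → x ≋ a ⊗ b → a ^ n ≋ 𝟘 → x ^ n ≋ 𝟘
    ^-vanishes-⊗ {a} {b} n x≋ab p =
      ≋-trans (^-cong n x≋ab) (≋-trans (^-distrib-⊗ a b n) (≋𝟘⇒⊗≋𝟘 (b ^ n) p))

  -- Substitutions and derivations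

  -- With no relations the presented algebra is the polynomial ring, where all integration takes
  -- place.
  free : {V : Set} → ⊥ → Term V
  free ()

  module Free {V : Set} = Alg {V} free

  substitute-var : (a : Term V) → a [ var ] ≡ a
  substitute-var (var x) = ≡.refl
  substitute-var (con x) = ≡.refl
  substitute-var (a ⊕ b) = ≡.cong₂ _⊕_ (substitute-var a) (substitute-var b)
  substitute-var (a ⊗ b) = ≡.cong₂ _⊗_ (substitute-var a) (substitute-var b)
  substitute-var (⊝ a)   = ≡.cong ⊝_ (substitute-var a)

  substitute-substitute : (a : Term U) (g : U → Term V) (h : V → Term W) →
                          a [ g ] [ h ] ≡ a [ (λ u → g u [ h ]) ]
  substitute-substitute (var x) g h = ≡.refl
  substitute-substitute (con x) g h = ≡.refl
  substitute-substitute (a ⊕ b) g h = ≡.cong₂ _⊕_ (substitute-substitute a g h) (substitute-substitute b g h)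
  substitute-substitute (a ⊗ b) g h = ≡.cong₂ _⊗_ (substitute-substitute a g h) (substitute-substitute b g h)
  substitute-substitute (⊝ a)   g h = ≡.cong ⊝_ (substitute-substitute a g h)

  ⨁-substitute : ∀ {k} (f : Fin k → Term V) (g : V → Term W) → ⨁ f [ g ] ≡ ⨁ (λ i → f i [ g ])
  ⨁-substitute {k = zero}  f g = ≡.refl
  ⨁-substitute {k = suc k} f g = ≡.cong (f zero [ g ] ⊕_) (⨁-substitute (λ i → f (suc i)) g)

  ⨂-substitute : ∀ {k} (f : Fin k → Term V) (g : V → Term W) → ⨂ f [ g ] ≡ ⨂ (λ i → f i [ g ])
  ⨂-substitute {k = zero}  f g = ≡.refl
  ⨂-substitute {k = suc k} f g = ≡.cong (f zero [ g ] ⊗_) (⨂-substitute (λ i → f (suc i)) g)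

  ^-substitute : (a : Term V) (n : ℕ) (g : V → Term W) → (a ^ n) [ g ] ≡ (a [ g ]) ^ n
  ^-substitute a zero    g = ≡.refl
  ^-substitute a (suc n) g = ≡.cong (a [ g ] ⊗_) (^-substitute a n g)

  -- A derivation along the substitution `g`: both factors in the Leibniz rule are evaluated through
  -- `g`. With `g = var` it is a vector field on polynomials; with `g = delete` it extracts the
  -- coefficient of the first edge variable.
  derive : (V → Term W) → (V → Term W) → Term V → Term W
  derive g δ (var v) = δ v
  derive g δ (con k) = 𝟘
  derive g δ (a ⊕ b) = derive g δ a ⊕ derive g δ b
  derive g δ (a ⊗ b) = (a [ g ]) ⊗ derive g δ b ⊕ derive g δ a ⊗ (b [ g ])
  derive g δ (⊝ a)   = ⊝ derive g δ a

  module _ {W S : Set} (rel′ : S → Term W) where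
    open Alg rel′

    substitute-pointwise : (a : Term V) {g h : V → Term W} → (∀ v → g v ≋ h v) → a [ g ] ≋ a [ h ]
    substitute-pointwise (var x) p = p x
    substitute-pointwise (con x) p = ≋-refl
    substitute-pointwise (a ⊕ b) p = ⊕-cong (substitute-pointwise a p) (substitute-pointwise b p)
    substitute-pointwise (a ⊗ b) p = ⊗-cong (substitute-pointwise a p) (substitute-pointwise b p)
    substitute-pointwise (⊝ a)   p = ⊝-cong (substitute-pointwise a p)

    module _ {V R : Set} (rel : R → Term V) (g : V → Term W) (rel[g]≋𝟘 : ∀ r → rel r [ g ] ≋ 𝟘) where
      private module P = Presentation rel

      substitute-cong : ∀ {a b} → a P.≋ b → a [ g ] ≋ b [ g ]
      substitute-cong ≋-refl              = ≋-refl
      substitute-cong (≋-sym p)           = ≋-sym (substitute-cong p)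
      substitute-cong (≋-trans p q)       = ≋-trans (substitute-cong p) (substitute-cong q)
      substitute-cong (⊕-cong p q)        = ⊕-cong (substitute-cong p) (substitute-cong q)
      substitute-cong (⊗-cong p q)        = ⊗-cong (substitute-cong p) (substitute-cong q)
      substitute-cong (⊝-cong p)          = ⊝-cong (substitute-cong p)
      substitute-cong (con-cong p)        = con-cong p
      substitute-cong (con-+ k l)         = con-+ k l
      substitute-cong (con-* k l)         = con-* k l
      substitute-cong (⊕-assoc a b d)     = ⊕-assoc _ _ _
      substitute-cong (⊕-comm a b)        = ⊕-comm _ _
      substitute-cong (⊕-idˡ a)           = ⊕-idˡ _
      substitute-cong (⊝-invˡ a)          = ⊝-invˡ _
      substitute-cong (⊗-assoc a b d)     = ⊗-assoc _ _ _
      substitute-cong (⊗-comm a b)        = ⊗-comm _ _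
      substitute-cong (⊗-idˡ a)           = ⊗-idˡ _
      substitute-cong (distribˡ a b d)    = distribˡ _ _ _
      substitute-cong (relation r)        = rel[g]≋𝟘 r

      -- The Leibniz rule also involves values under `g`, so `g` has to respect the relations as
      -- well as `δ`.
      derive-cong : (δ : V → Term W) → (∀ r → derive g δ (rel r) ≋ 𝟘) →
                    ∀ {a b} → a P.≋ b → derive g δ a ≋ derive g δ b
      derive-cong δ δrel≋𝟘 = go
        where
        go : ∀ {a b} → a P.≋ b → derive g δ a ≋ derive g δ b
        go ≋-refl              = ≋-refl
        go (≋-sym p)           = ≋-sym (go p)
        go (≋-trans p q)       = ≋-trans (go p) (go q)
        go (⊕-cong p q)        = ⊕-cong (go p) (go q)
        go (⊗-cong p q)        = ⊕-cong (⊗-cong (substitute-cong p) (go q)) (⊗-cong (go p) (substitute-cong q))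
        go (⊝-cong p)          = ⊝-cong (go p)
        go (con-cong p)        = ≋-refl
        go (con-+ k l)         = ≋-sym (⊕-idˡ 𝟘)
        go (con-* k l)         = solve 2 (λ x y → :0 := (x :* :0) :+ (:0 :* y)) ≋-refl (con k) (con l)
        go (⊕-assoc a b d)     = ⊕-assoc _ _ _
        go (⊕-comm a b)        = ⊕-comm _ _
        go (⊕-idˡ a)           = ⊕-idˡ _
        go (⊝-invˡ a)          = ⊝-invˡ _
        go (⊗-assoc a b d)     = solve 6 (λ a b d a′ b′ d′ →
          (a :* b) :* d′ :+ (a :* b′ :+ a′ :* b) :* d := a :* (b :* d′ :+ b′ :* d) :+ a′ :* (b :* d)) ≋-refl
          (a [ g ]) (b [ g ]) (d [ g ]) (derive g δ a) (derive g δ b) (derive g δ d)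
        go (⊗-comm a b)        = solve 4 (λ a b a′ b′ → a :* b′ :+ a′ :* b := b :* a′ :+ b′ :* a) ≋-refl
          (a [ g ]) (b [ g ]) (derive g δ a) (derive g δ b)
        go (⊗-idˡ a)           = solve 2 (λ a a′ → :1 :* a′ :+ :0 :* a := a′) ≋-refl (a [ g ]) (derive g δ a)
        go (distribˡ a b d)    = solve 6 (λ a b d a′ b′ d′ →
          a :* (b′ :+ d′) :+ a′ :* (b :+ d) := (a :* b′ :+ a′ :* b) :+ (a :* d′ :+ a′ :* d)) ≋-refl
          (a [ g ]) (b [ g ]) (d [ g ]) (derive g δ a) (derive g δ b) (derive g δ d)
        go (relation r)        = δrel≋𝟘 r

    from-free : ∀ {a b : Term W} → Presentation._≋_ free a b → a ≋ b
    from-free {a} {b} p = ≡.subst₂ _≋_ (substitute-var a) (substitute-var b) (substitute-cong free var (λ ()) p)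

    -- Both sides are derivations of `p` along `h`, so agreement on the variables suffices. It
    -- serves to show that the coefficient of the first edge variable in p(X) is ∂p evaluated on the
    -- deletion.
    chain-rule : (p : Term V) (f : V → Term U) (g δ : U → Term W) (h : V → Term W) (δ′ : V → Term V) →
                 (∀ v → f v [ g ] ≋ h v) → (∀ v → derive g δ (f v) ≋ δ′ v [ h ]) →
                 derive g δ (p [ f ]) ≋ derive var δ′ p [ h ]
    chain-rule {V = V} p f g δ h δ′ fg≋h δf≋δ′h = go p
      where
      fgh : (a : Term V) → a [ f ] [ g ] ≋ a [ var ] [ h ]
      fgh a = ≋-trans (≋-reflexive (substitute-substitute a f g))
        (≋-trans (substitute-pointwise a fg≋h) (≋-reflexive (≡.cong _[ h ] (≡.sym (substitute-var a)))))
      go : ∀ a → derive g δ (a [ f ]) ≋ derive var δ′ a [ h ]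
      go (var v) = δf≋δ′h v
      go (con k) = ≋-refl
      go (a ⊕ b) = ⊕-cong (go a) (go b)
      go (a ⊗ b) = ⊕-cong (⊗-cong (fgh a) (go b)) (⊗-cong (go a) (fgh b))
      go (⊝ a)   = ⊝-cong (go a)


  -- Integration along a constant vector field

  -- This is 1/(k + 1); characteristic zero enters the proof here.
  recip : ℕ → Carrier
  recip k = proj₁ (IsFieldOfChar0.inv isField (natK K (suc k)) (IsFieldOfChar0.char0 isField k))

  recip-inverse : ∀ k → natK K (suc k) * recip k ≈ 1#
  recip-inverse k = proj₂ (IsFieldOfChar0.inv isField (natK K (suc k)) (IsFieldOfChar0.char0 isField k))

  module _ {V R : Set} (rel : R → Term V) where
    private module P = Presentation rel
    open Free {V}

    -- Explicit combinations of the relations over the polynomial ring. A derivation of `a ≋ 𝟘` in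
    -- the quotient passes through arbitrary intermediate terms and cannot be integrated step by
    -- step; such a combination can.
    data Ideal : Term V → Set (c ⊔ ℓ) where
      ideal-𝟘    : Ideal 𝟘
      ideal-⊕    : ∀ {a b} → Ideal a → Ideal b → Ideal (a ⊕ b)
      ideal-gen  : ∀ q r → Ideal (q ⊗ rel r)
      ideal-resp : ∀ {a b} → a ≋ b → Ideal a → Ideal b

    ideal-⊗ : ∀ q {a} → Ideal a → Ideal (q ⊗ a)
    ideal-⊗ q ideal-𝟘            = ideal-resp (≋-sym (⊗-zeroʳ q)) ideal-𝟘
    ideal-⊗ q (ideal-⊕ x y)      = ideal-resp (≋-sym (distribˡ q _ _)) (ideal-⊕ (ideal-⊗ q x) (ideal-⊗ q y))
    ideal-⊗ q (ideal-gen p r)    = ideal-resp (⊗-assoc q p (rel r)) (ideal-gen (q ⊗ p) r)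
    ideal-⊗ q (ideal-resp eq x)  = ideal-resp (⊗-congˡ eq) (ideal-⊗ q x)

    -- Induction on the derivation: symmetry multiplies by -1, transitivity telescopes, a product
    -- splits as ab - a'b' = b(a - a') + a'(b - b'), and the ring axioms contribute zero.
    ≋⇒ideal : ∀ {a b} → a P.≋ b → Ideal (a ⊖ b)
    ≋⇒ideal = go
      where
      free-case : ∀ {a b} → a ≋ b → Ideal (a ⊖ b)
      free-case eq = ideal-resp (≋-sym (≋⇒⊖≋𝟘 eq)) ideal-𝟘
      go : ∀ {a b} → a P.≋ b → Ideal (a ⊖ b)
      go ≋-refl = free-case ≋-refl
      go {a} {b} (≋-sym p) = ideal-resp
        (solve 2 (λ a b → (:- :1) :* (b :- a) := a :- b) ≋-refl a b) (ideal-⊗ (⊝ 𝟙) (go p))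
      go {a} {b} (≋-trans {b = d} p q) = ideal-resp
        (solve 3 (λ a b d → (a :- d) :+ (d :- b) := a :- b) ≋-refl a b d) (ideal-⊕ (go p) (go q))
      go (⊕-cong {a} {a'} {b} {b'} p q) = ideal-resp
        (solve 4 (λ a a' b b' → (a :- a') :+ (b :- b') := (a :+ b) :- (a' :+ b')) ≋-refl a a' b b')
        (ideal-⊕ (go p) (go q))
      go (⊗-cong {a} {a'} {b} {b'} p q) = ideal-resp
        (solve 4 (λ a a' b b' → b :* (a :- a') :+ a' :* (b :- b') := (a :* b) :- (a' :* b')) ≋-refl a a' b b')
        (ideal-⊕ (ideal-⊗ b (go p)) (ideal-⊗ a' (go q)))
      go (⊝-cong {a} {a'} p) = ideal-resp
        (solve 2 (λ a a' → (:- :1) :* (a :- a') := (:- a) :- (:- a')) ≋-refl a a') (ideal-⊗ (⊝ 𝟙) (go p))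
      go (con-cong p)     = free-case (con-cong p)
      go (con-+ k l)      = free-case (con-+ k l)
      go (con-* k l)      = free-case (con-* k l)
      go (⊕-assoc a b d)  = free-case (⊕-assoc a b d)
      go (⊕-comm a b)     = free-case (⊕-comm a b)
      go (⊕-idˡ a)        = free-case (⊕-idˡ a)
      go (⊝-invˡ a)       = free-case (⊝-invˡ a)
      go (⊗-assoc a b d)  = free-case (⊗-assoc a b d)
      go (⊗-comm a b)     = free-case (⊗-comm a b)
      go (⊗-idˡ a)        = free-case (⊗-idˡ a)
      go (distribˡ a b d) = free-case (distribˡ a b d)
      go (relation r)     = ideal-resp
        (solve 1 (λ x → :1 :* x := x :- :0) ≋-refl (rel r)) (ideal-gen 𝟙 r)

    ≋𝟘⇒ideal : ∀ {a} → a P.≋ 𝟘 → Ideal a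
    ≋𝟘⇒ideal {a} p = ideal-resp (solve 1 (λ a → a :- :0 := a) ≋-refl a) (≋⇒ideal p)

  module ConstantDerivation {V : Set} (slope : V → Carrier) where
    open Free {V}
    open Relation.Binary.Reasoning.Setoid setoid

    ∂ : Term V → Term V
    ∂ = derive var (λ v → con (slope v))

    ∂-cong : ∀ {a b} → a ≋ b → ∂ a ≋ ∂ b
    ∂-cong = derive-cong free free var (λ ()) _ (λ ())

    ∂-⊗ : ∀ a b → ∂ (a ⊗ b) ≋ a ⊗ ∂ b ⊕ ∂ a ⊗ b
    ∂-⊗ a b = ≋-reflexive (≡.cong₂ (λ x y → x ⊗ ∂ b ⊕ ∂ a ⊗ y) (substitute-var a) (substitute-var b))

    ∂-con-⊗ : ∀ k a → ∂ (con k ⊗ a) ≋ con k ⊗ ∂ a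
    ∂-con-⊗ k a = ≋-trans (∂-⊗ (con k) a)
      (solve 3 (λ k a a′ → k :* a′ :+ :0 :* a := k :* a′) ≋-refl (con k) a (∂ a))

    ∂-⊗-constant : ∀ a b → ∂ b ≋ 𝟘 → ∂ (a ⊗ b) ≋ ∂ a ⊗ b
    ∂-⊗-constant a b ∂b≋𝟘 = ≋-trans (∂-⊗ a b)
      (≋-trans (⊕-congʳ (≋𝟘⇒⊗≋𝟘ʳ a ∂b≋𝟘)) (⊕-idˡ _))

    ∂-^-constant : ∀ a n → ∂ a ≋ 𝟘 → ∂ (a ^ n) ≋ 𝟘
    ∂-^-constant a zero    p = ≋-refl
    ∂-^-constant a (suc n) p = ≋-trans (∂-⊗-constant a (a ^ n) (∂-^-constant a n p)) (≋𝟘⇒⊗≋𝟘 (a ^ n) p)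

    ∂-^ : ∀ {x u} → ∂ x ≋ con u → ∀ d → ∂ (x ^ suc d) ≋ con (natK K (suc d) * u) ⊗ x ^ d
    ∂-^ {x} {u} ∂x≋u zero = begin
      ∂ (x ⊗ 𝟙)               ≈⟨ ∂-⊗ x 𝟙 ⟩
      x ⊗ 𝟘 ⊕ ∂ x ⊗ 𝟙         ≈⟨ solve 2 (λ x y → x :* :0 :+ y :* :1 := y :* :1) ≋-refl x (∂ x) ⟩
      ∂ x ⊗ 𝟙                 ≈⟨ ⊗-congʳ ∂x≋u ⟩
      con u ⊗ 𝟙               ≈⟨ ⊗-congʳ (con-cong (u≈[1+0]u u)) ⟩
      con ((1# + 0#) * u) ⊗ 𝟙 ∎
    ∂-^ {x} {u} ∂x≋u (suc d) = begin
      ∂ (x ⊗ x ^ suc d)                                ≈⟨ ∂-⊗ x (x ^ suc d) ⟩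
      x ⊗ ∂ (x ^ suc d) ⊕ ∂ x ⊗ x ^ suc d              ≈⟨ ⊕-cong (⊗-congˡ (∂-^ ∂x≋u d)) (⊗-congʳ ∂x≋u) ⟩
      x ⊗ (con k ⊗ x ^ d) ⊕ con u ⊗ (x ⊗ x ^ d)
        ≈⟨ solve 4 (λ x k y u → x :* (k :* y) :+ u :* (x :* y) := (u :+ k) :* (x :* y)) ≋-refl x (con k) (x ^ d) (con u) ⟩
      (con u ⊕ con k) ⊗ x ^ suc d                      ≈⟨ ⊗-congʳ (con-+ u k) ⟨
      con (u + k) ⊗ x ^ suc d
        ≈⟨ ⊗-congʳ (con-cong (u+nu≈[1+n]u u (natK K (suc d)))) ⟩
      con (natK K (suc (suc d)) * u) ⊗ x ^ suc d       ∎
      where k = natK K (suc d) * u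

    -- A substitute for the degree of a polynomial as induction measure: terms have no normal form,
    -- but each is killed by some power of ∂.
    Nilpotent : ℕ → Term V → Set (c ⊔ ℓ)
    Nilpotent zero    p = p ≋ 𝟘
    Nilpotent (suc n) p = Nilpotent n (∂ p)

    nilpotent-cong : ∀ n {a b} → a ≋ b → Nilpotent n a → Nilpotent n b
    nilpotent-cong zero    a≋b p = ≋-trans (≋-sym a≋b) p
    nilpotent-cong (suc n) a≋b p = nilpotent-cong n (∂-cong a≋b) p

    nilpotent-𝟘 : ∀ n {a} → a ≋ 𝟘 → Nilpotent n a
    nilpotent-𝟘 zero    a≋𝟘 = a≋𝟘
    nilpotent-𝟘 (suc n) a≋𝟘 = nilpotent-𝟘 n (∂-cong a≋𝟘)

    nilpotent-+ : ∀ n m {a} → Nilpotent n a → Nilpotent (n ℕ.+ m) a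
    nilpotent-+ zero    m p = nilpotent-𝟘 m p
    nilpotent-+ (suc n) m p = nilpotent-+ n m p

    nilpotent-⊕ : ∀ n {a b} → Nilpotent n a → Nilpotent n b → Nilpotent n (a ⊕ b)
    nilpotent-⊕ zero    p q = ⊕≋𝟘 p q
    nilpotent-⊕ (suc n) p q = nilpotent-⊕ n p q

    nilpotent-⊝ : ∀ n {a} → Nilpotent n a → Nilpotent n (⊝ a)
    nilpotent-⊝ zero    p = ⊝≋𝟘 p
    nilpotent-⊝ (suc n) p = nilpotent-⊝ n p

    -- By the Leibniz rule each application of ∂ lowers the order of one of the two factors.
    nilpotent-⊗ : ∀ n m {a b} → Nilpotent n a → Nilpotent m b → Nilpotent (n ℕ.+ m) (a ⊗ b)
    nilpotent-⊗ zero    m       {a} {b} p q = nilpotent-𝟘 m (≋𝟘⇒⊗≋𝟘 b p)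
    nilpotent-⊗ (suc n) zero    {a} {b} p q = nilpotent-𝟘 (suc n ℕ.+ 0) (≋𝟘⇒⊗≋𝟘ʳ a q)
    nilpotent-⊗ (suc n) (suc m) {a} {b} p q = nilpotent-cong (n ℕ.+ suc m) (≋-sym (∂-⊗ a b))
      (nilpotent-⊕ (n ℕ.+ suc m)
        (≡.subst (λ k → Nilpotent k (a ⊗ ∂ b)) (≡.sym (ℕ.+-suc n m)) (nilpotent-⊗ (suc n) m {a} p q))
        (nilpotent-⊗ n (suc m) p q))

    nilpotent : ∀ p → ∃ λ n → Nilpotent n p
    nilpotent (var v) = 2 , ≋-refl
    nilpotent (con k) = 1 , ≋-refl
    nilpotent (a ⊕ b) with nilpotent a | nilpotent b
    ... | n , p | m , q = n ℕ.+ m , nilpotent-⊕ (n ℕ.+ m) (nilpotent-+ n m p)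
      (≡.subst (λ k → Nilpotent k b) (ℕ.+-comm m n) (nilpotent-+ m n q))
    nilpotent (a ⊗ b) with nilpotent a | nilpotent b
    ... | n , p | m , q = n ℕ.+ m , nilpotent-⊗ n m p q
    nilpotent (⊝ a) with nilpotent a
    ... | n , p = n , nilpotent-⊝ n p

    -- Repeated integration by parts; it stops because ∂ is locally nilpotent.
    antiderivative : ∀ {x u u⁻¹} → u * u⁻¹ ≈ 1# → ∂ x ≋ con u →
                     ∀ q d → ∃ λ w → ∂ (w ⊗ x ^ suc d) ≋ q ⊗ x ^ d
    antiderivative {x} {u} {u⁻¹} uu⁻¹≈1 ∂x≋u q d = go (proj₁ (nilpotent q)) q d (proj₂ (nilpotent q))
      where
      go : ∀ n q d → Nilpotent n q → ∃ λ w → ∂ (w ⊗ x ^ suc d) ≋ q ⊗ x ^ d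
      go zero    q d q≋𝟘 = 𝟘 , ≋-trans (∂-cong (⊗-zeroˡ (x ^ suc d))) (≋-sym (≋𝟘⇒⊗≋𝟘 (x ^ d) q≋𝟘))
      go (suc n) q d nil with go n (∂ q) (suc d) nil
      -- The derivative of q x^(d+1) is (d+1) u q x^d plus ∂q x^(d+1). The term with `w′` cancels
      -- the latter, and `k` is the inverse of (d+1) u.
      ... | w′ , eq = con k ⊗ (q ⊖ (w′ ⊗ x)) , (begin
        ∂ (con k ⊗ (q ⊖ (w′ ⊗ x)) ⊗ x ^ suc d)
          ≈⟨ ∂-cong (solve 5 (λ k q w x y → k :* (q :- w :* x) :* y := k :* (q :* y :- w :* (x :* y)))
              ≋-refl (con k) q w′ x (x ^ suc d)) ⟩
        ∂ (con k ⊗ ((q ⊗ x ^ suc d) ⊖ (w′ ⊗ x ^ suc (suc d))))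
          ≈⟨ ∂-con-⊗ k ((q ⊗ x ^ suc d) ⊖ (w′ ⊗ x ^ suc (suc d))) ⟩
        con k ⊗ (∂ (q ⊗ x ^ suc d) ⊖ ∂ (w′ ⊗ x ^ suc (suc d)))
          ≈⟨ ⊗-congˡ (⊕-cong (≋-trans (∂-⊗ q (x ^ suc d)) (⊕-congʳ (⊗-congˡ (∂-^ ∂x≋u d)))) (⊝-cong eq)) ⟩
        con k ⊗ ((q ⊗ (con m ⊗ x ^ d) ⊕ ∂ q ⊗ x ^ suc d) ⊖ (∂ q ⊗ x ^ suc d))
          ≈⟨ solve 5 (λ k q m y z → k :* ((q :* (m :* y) :+ z) :- z) := (k :* m) :* (q :* y))
              ≋-refl (con k) q (con m) (x ^ d) (∂ q ⊗ x ^ suc d) ⟩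
        (con k ⊗ con m) ⊗ (q ⊗ x ^ d)
          ≈⟨ ⊗-congʳ (≋-trans (≋-sym (con-* k m)) (con-cong km≈1)) ⟩
        𝟙 ⊗ (q ⊗ x ^ d)
          ≈⟨ ⊗-idˡ _ ⟩
        q ⊗ x ^ d ∎)
        where
        k = u⁻¹ * recip d
        m = natK K (suc d) * u
        km≈1 : k * m ≈ 1#
        km≈1 = 𝕂.trans ([ab][cd]≈[da][cb] u⁻¹ (recip d) (natK K (suc d)) u)
          (𝕂.trans (𝕂.*-cong uu⁻¹≈1 (recip-inverse d)) (𝕂.*-identityˡ 1#))

    module _ {t : Term V} (∂t≋𝟙 : ∂ t ≋ 𝟙) where

      -- w = t^{-k-1} solves this equation; no polynomial does, except 0.
      euler-equation-trivial : ∀ n k w → Nilpotent n w → con (natK K (suc k)) ⊗ w ⊕ t ⊗ ∂ w ≋ 𝟘 → w ≋ 𝟘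
      euler-equation-trivial zero    k w w≋𝟘 _  = w≋𝟘
      euler-equation-trivial (suc n) k w nil eq = begin
        w                                            ≈⟨ ⊗-idˡ w ⟨
        𝟙 ⊗ w                                        ≈⟨ ⊗-congʳ (con-cong (recip-inverse k)) ⟨
        con (natK K (suc k) * recip k) ⊗ w           ≈⟨ ⊗-congʳ (con-* _ _) ⟩
        con (natK K (suc k)) ⊗ con (recip k) ⊗ w
          ≈⟨ solve 4 (λ a b w t → a :* b :* w := b :* (a :* w :+ t :* :0))
              ≋-refl (con (natK K (suc k))) (con (recip k)) w t ⟩
        con (recip k) ⊗ (con (natK K (suc k)) ⊗ w ⊕ t ⊗ 𝟘)  ≈⟨ ⊗-congˡ (⊕-congˡ (⊗-congˡ ∂w≋𝟘)) ⟨
        con (recip k) ⊗ (con (natK K (suc k)) ⊗ w ⊕ t ⊗ ∂ w) ≈⟨ ≋𝟘⇒⊗≋𝟘ʳ _ eq ⟩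
        𝟘 ∎
        where
        ∂w≋𝟘 : ∂ w ≋ 𝟘
        -- Differentiating the equation gives the same one for `∂ w` with k + 1 in place of k, and
        -- `∂ w` has smaller nilpotency order.
        ∂w≋𝟘 = euler-equation-trivial n (suc k) (∂ w) nil (begin
          con (1# + natK K (suc k)) ⊗ ∂ w ⊕ t ⊗ ∂ (∂ w)
            ≈⟨ ⊕-congʳ (⊗-congʳ (con-+ _ _)) ⟩
          (𝟙 ⊕ con (natK K (suc k))) ⊗ ∂ w ⊕ t ⊗ ∂ (∂ w)
            ≈⟨ solve 4 (λ k w t w′ → (:1 :+ k) :* w :+ t :* w′ := k :* w :+ (t :* w′ :+ :1 :* w))
                ≋-refl (con (natK K (suc k))) (∂ w) t (∂ (∂ w)) ⟩
          con (natK K (suc k)) ⊗ ∂ w ⊕ (t ⊗ ∂ (∂ w) ⊕ 𝟙 ⊗ ∂ w)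
            ≈⟨ ⊕-cong (∂-con-⊗ (natK K (suc k)) w) (≋-trans (∂-⊗ t (∂ w)) (⊕-congˡ (⊗-congʳ ∂t≋𝟙))) ⟨
          ∂ (con (natK K (suc k)) ⊗ w ⊕ t ⊗ ∂ w)
            ≈⟨ ∂-cong eq ⟩
          𝟘 ∎)

      module _ (σ : V → Term V) (∂σ≋𝟘 : ∀ v → ∂ (σ v) ≋ 𝟘)
               (σ-mod-t : ∀ v → ∃ λ w → var v ≋ σ v ⊕ t ⊗ w) where

        ∂-substitute-σ : ∀ p → ∂ (p [ σ ]) ≋ 𝟘
        ∂-substitute-σ (var v) = ∂σ≋𝟘 v
        ∂-substitute-σ (con k) = ≋-refl
        ∂-substitute-σ (a ⊕ b) = ⊕≋𝟘 (∂-substitute-σ a) (∂-substitute-σ b)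
        ∂-substitute-σ (a ⊗ b) = ≋-trans (∂-⊗-constant (a [ σ ]) (b [ σ ]) (∂-substitute-σ b))
                                         (≋𝟘⇒⊗≋𝟘 (b [ σ ]) (∂-substitute-σ a))
        ∂-substitute-σ (⊝ a)   = ⊝≋𝟘 (∂-substitute-σ a)

        substitute-σ-mod-t : ∀ p → ∃ λ w → p ≋ (p [ σ ]) ⊕ t ⊗ w
        substitute-σ-mod-t (var v) = σ-mod-t v
        substitute-σ-mod-t (con k) = 𝟘 , solve 2 (λ k t → k := k :+ t :* :0) ≋-refl (con k) t
        substitute-σ-mod-t (a ⊕ b) with substitute-σ-mod-t a | substitute-σ-mod-t b
        ... | v , p | w , q = v ⊕ w , ≋-trans (⊕-cong p q)
          (solve 5 (λ a b t v w → (a :+ t :* v) :+ (b :+ t :* w) := (a :+ b) :+ t :* (v :+ w))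
              ≋-refl (a [ σ ]) (b [ σ ]) t v w)
        substitute-σ-mod-t (a ⊗ b) with substitute-σ-mod-t a | substitute-σ-mod-t b
        ... | v , p | w , q = (a [ σ ]) ⊗ w ⊕ v ⊗ ((b [ σ ]) ⊕ t ⊗ w) , ≋-trans (⊗-cong p q)
          (solve 5 (λ a b t v w → (a :+ t :* v) :* (b :+ t :* w) := (a :* b) :+ t :* (a :* w :+ v :* (b :+ t :* w)))
              ≋-refl (a [ σ ]) (b [ σ ]) t v w)
        substitute-σ-mod-t (⊝ a) with substitute-σ-mod-t a
        ... | v , p = ⊝ v , ≋-trans (⊝-cong p)
          (solve 3 (λ a t v → :- (a :+ t :* v) := (:- a) :+ t :* (:- v)) ≋-refl (a [ σ ]) t v)

        -- Write p = p[σ] + t w. Both p and p[σ] are constants of ∂, so 0 = ∂(t w) = w + t ∂w, and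
        -- this Euler equation forces w = 0.
        ∂≋𝟘⇒σ-invariant : ∀ p → ∂ p ≋ 𝟘 → p ≋ p [ σ ]
        ∂≋𝟘⇒σ-invariant p ∂p≋𝟘 with substitute-σ-mod-t p
        ... | w , eq = ≋-trans eq (≋-trans (⊕-congˡ (≋𝟘⇒⊗≋𝟘ʳ t w≋𝟘)) (⊕-idʳ _))
          where
          w≋𝟘 : w ≋ 𝟘
          w≋𝟘 = euler-equation-trivial (proj₁ (nilpotent w)) 0 w (proj₂ (nilpotent w)) (begin
            con (1# + 0#) ⊗ w ⊕ t ⊗ ∂ w   ≈⟨ ⊕-congʳ (⊗-congʳ (con-cong (𝕂.+-identityʳ 1#))) ⟩
            𝟙 ⊗ w ⊕ t ⊗ ∂ w               ≈⟨ ⊕-congʳ (⊗-congʳ ∂t≋𝟙) ⟨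
            ∂ t ⊗ w ⊕ t ⊗ ∂ w             ≈⟨ ⊕-comm _ _ ⟩
            t ⊗ ∂ w ⊕ ∂ t ⊗ w             ≈⟨ ∂-⊗ t w ⟨
            ∂ (t ⊗ w)                     ≈⟨ ⊕-idˡ _ ⟨
            𝟘 ⊕ ∂ (t ⊗ w)                 ≈⟨ ⊕-congʳ (∂-substitute-σ p) ⟨
            ∂ (p [ σ ]) ⊕ ∂ (t ⊗ w)       ≈⟨ ∂-cong eq ⟨
            ∂ p                           ≈⟨ ∂p≋𝟘 ⟩
            𝟘 ∎)

  open Algebra.Properties.Semiring.Sum 𝕂.semiring using (sum; sum-cong-≋; ∑-distrib-+; sum-replicate-zero)

  -- Linear forms

  indicator : Bool → Carrier
  indicator b = if b then 1# else 0#

  kronecker : ∀ {k} → Fin k → Fin k → Carrier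
  kronecker v i = indicator (does (v ≟ i))

  kronecker-refl : ∀ {k} (i : Fin k) → kronecker i i ≡ 1#
  kronecker-refl i = ≡.cong indicator (dec-true (i ≟ i) ≡.refl)

  kronecker-≢ : ∀ {k} {i j : Fin k} → i ≢ j → kronecker i j ≡ 0#
  kronecker-≢ {i = i} {j} i≢j = ≡.cong indicator (dec-false (i ≟ j) i≢j)

  kronecker-sym : ∀ {k} (i j : Fin k) → kronecker i j ≡ kronecker j i
  kronecker-sym i j with i ≟ j
  ... | yes ≡.refl = ≡.sym (kronecker-refl i)
  ... | no  i≢j    = ≡.sym (kronecker-≢ (λ j≡i → i≢j (≡.sym j≡i)))

  sum-zero : ∀ {k} (f : Fin k → Carrier) → (∀ i → f i ≈ 0#) → sum f ≈ 0#
  sum-zero {k} f f≈0 = 𝕂.trans (sum-cong-≋ f≈0) (sum-replicate-zero k)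

  sum-kronecker : ∀ {k} (f : Fin k → Carrier) w → sum (λ i → f i * kronecker w i) ≈ f w
  sum-kronecker {suc k} f zero = 𝕂.trans
    (𝕂.+-cong (𝕂.*-identityʳ (f zero)) (sum-zero (λ i → f (suc i) * 0#) (λ i → 𝕂.zeroʳ (f (suc i)))))
    (𝕂.+-identityʳ (f zero))
  sum-kronecker {suc k} f (suc w) = 𝕂.trans
    (𝕂.+-cong (𝕂.zeroʳ (f zero)) (sum-kronecker (λ i → f (suc i)) w)) (𝕂.+-identityˡ (f (suc w)))

  sum-neg : ∀ {k} (f : Fin k → Carrier) → sum (λ i → - f i) ≈ - sum f
  sum-neg {zero}  f = 0≈-0
  sum-neg {suc k} f = 𝕂.trans (𝕂.+-congˡ (sum-neg (λ i → f (suc i))))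
    (-x-y≈-[x+y] (f zero) (sum (λ i → f (suc i))))

  lincomb : ∀ {k} → (Fin k → Carrier) → (Fin k → Term V) → Term V
  lincomb α f = ⨁ (λ i → con (α i) ⊗ f i)

  linear : ∀ {k} → (Fin k → Carrier) → Term (Fin k)
  linear α = lincomb α var

  linear-substitute : ∀ {k} (α : Fin k → Carrier) (g : Fin k → Term V) → linear α [ g ] ≡ lincomb α g
  linear-substitute α g = ⨁-substitute (λ i → con (α i) ⊗ var i) g

  module Linear {V R : Set} (rel : R → Term V) where
    open Alg rel
    open Relation.Binary.Reasoning.Setoid setoid

    lincomb-cong : ∀ {k} {α β : Fin k → Carrier} (f : Fin k → Term V) → (∀ i → α i ≈ β i) →
                   lincomb α f ≋ lincomb β f
    lincomb-cong f α≈β = ⨁-cong (λ i → ⊗-congʳ (con-cong (α≈β i)))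

    lincomb-0 : ∀ {k} (α : Fin k → Carrier) (f : Fin k → Term V) → (∀ i → α i ≈ 0#) → lincomb α f ≋ 𝟘
    lincomb-0 {zero}  α f α≈0 = ≋-refl
    lincomb-0 {suc k} α f α≈0 =
      ⊕≋𝟘 (≋𝟘⇒⊗≋𝟘 (f zero) (con-cong (α≈0 zero))) (lincomb-0 _ (λ i → f (suc i)) (λ i → α≈0 (suc i)))

    lincomb-+ : ∀ {k} (α β : Fin k → Carrier) (f : Fin k → Term V) →
                lincomb (λ i → α i + β i) f ≋ lincomb α f ⊕ lincomb β f
    lincomb-+ {zero}  α β f = ≋-sym (⊕-idˡ 𝟘)
    lincomb-+ {suc k} α β f = ≋-trans
      (⊕-cong (⊗-congʳ (con-+ (α zero) (β zero))) (lincomb-+ (λ i → α (suc i)) (λ i → β (suc i)) (λ i → f (suc i))))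
      (solve 5 (λ a b f x y → (a :+ b) :* f :+ (x :+ y) := (a :* f :+ x) :+ (b :* f :+ y)) ≋-refl
        (con (α zero)) (con (β zero)) (f zero) _ _)

    lincomb-* : ∀ {k} c (α : Fin k → Carrier) (f : Fin k → Term V) →
                lincomb (λ i → c * α i) f ≋ con c ⊗ lincomb α f
    lincomb-* {zero}  c α f = ≋-sym (⊗-zeroʳ (con c))
    lincomb-* {suc k} c α f = ≋-trans
      (⊕-cong (⊗-congʳ (con-* c (α zero))) (lincomb-* c (λ i → α (suc i)) (λ i → f (suc i))))
      (solve 4 (λ c a f x → (c :* a) :* f :+ c :* x := c :* (a :* f :+ x)) ≋-refl (con c) (con (α zero)) (f zero) _)

    lincomb-kronecker : ∀ {k} (i : Fin k) (f : Fin k → Term V) → lincomb (kronecker i) f ≋ f i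
    lincomb-kronecker zero f = ≋-trans
      (⊕-cong (⊗-idˡ (f zero)) (lincomb-0 (λ _ → 0#) (λ i → f (suc i)) (λ _ → 𝕂.refl))) (⊕-idʳ (f zero))
    lincomb-kronecker (suc i) f = ≋-trans
      (⊕-cong (⊗-zeroˡ (f zero)) (lincomb-kronecker i (λ i → f (suc i)))) (⊕-idˡ (f (suc i)))

    lincomb-lincomb : ∀ {k l} (α : Fin k → Carrier) (β : Fin k → Fin l → Carrier) (f : Fin l → Term V) →
                      lincomb α (λ i → lincomb (β i) f) ≋ lincomb (λ e → sum (λ i → α i * β i e)) f
    lincomb-lincomb {zero}  α β f = ≋-sym (lincomb-0 (λ _ → 0#) f (λ _ → 𝕂.refl))
    lincomb-lincomb {suc k} α β f = ≋-sym (≋-trans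
      (lincomb-+ (λ e → α zero * β zero e) (λ e → sum (λ i → α (suc i) * β (suc i) e)) f)
      (⊕-cong (lincomb-* (α zero) (β zero) f)
              (≋-sym (lincomb-lincomb (λ i → α (suc i)) (λ i → β (suc i)) f))))

    derive-lincomb : ∀ {k} {U : Set} (g : U → Term V) (slope : U → Carrier) (α : Fin k → Carrier) (h : Fin k → U) →
                     derive g (λ u → con (slope u)) (lincomb α (λ i → var (h i))) ≋ con (sum (λ i → α i * slope (h i)))
    derive-lincomb {zero}  g slope α h = ≋-refl
    derive-lincomb {suc k} g slope α h = begin
      (con (α zero) ⊗ con (slope (h zero)) ⊕ 𝟘 ⊗ g (h zero)) ⊕ derive g (λ u → con (slope u)) (lincomb (λ i → α (suc i)) (λ i → var (h (suc i))))
        ≈⟨ ⊕-cong (≋-trans (⊕-congˡ (⊗-zeroˡ _)) (⊕-idʳ _)) (derive-lincomb g slope (λ i → α (suc i)) (λ i → h (suc i))) ⟩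
      con (α zero) ⊗ con (slope (h zero)) ⊕ con (sum (λ i → α (suc i) * slope (h (suc i))))
        ≈⟨ ⊕-congʳ (con-* _ _) ⟨
      con (α zero * slope (h zero)) ⊕ con (sum (λ i → α (suc i) * slope (h (suc i))))
        ≈⟨ con-+ _ _ ⟨
      con (sum (λ i → α i * slope (h i))) ∎

    linear-linear : ∀ {k l} (α : Fin k → Carrier) (β : Fin k → Fin l → Carrier) (f : Fin l → Term V) →
                    linear α [ (λ i → lincomb (β i) f) ] ≋ lincomb (λ e → sum (λ i → α i * β i e)) f
    linear-linear α β f =
      ≋-trans (≋-reflexive (linear-substitute α (λ i → lincomb (β i) f))) (lincomb-lincomb α β f)

  -- The recursion of `countEdges`, but independent of a `Graph`: contraction produces loops, which
  -- a `Graph` excludes.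
  count : ∀ {m} → (Fin m → Bool) → ℕ
  count {zero}  p = zero
  count {suc m} p = (if p zero then 1 else 0) ℕ.+ count (λ e → p (suc e))

  count≤ : ∀ {m} (p : Fin m → Bool) → count p ℕ.≤ m
  count≤ {zero}  p = ℕ.z≤n
  count≤ {suc m} p with p zero
  ... | true  = ℕ.s≤s (count≤ (λ e → p (suc e)))
  ... | false = ℕ.m≤n⇒m≤1+n (count≤ (λ e → p (suc e)))

  -- Powers of sums of square-zero elements

  module _ {V R : Set} (rel : R → Term V) where
    open Alg rel
    open Relation.Binary.Reasoning.Setoid setoid

    -- The binomial expansion stops after two terms because a² = 0. Factoring out b^n lets its
    -- vanishing kill both.
    square-zero-⊕-^ : ∀ {a} b n → a ⊗ a ≋ 𝟘 → (a ⊕ b) ^ suc n ≋ b ^ n ⊗ (b ⊕ con (natK K (suc n)) ⊗ a)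
    square-zero-⊕-^ {a} b zero a²≋𝟘 = begin
      (a ⊕ b) ⊗ 𝟙                        ≈⟨ solve 2 (λ a b → (a :+ b) :* :1 := :1 :* (b :+ :1 :* a)) ≋-refl a b ⟩
      𝟙 ⊗ (b ⊕ 𝟙 ⊗ a)                    ≈⟨ ⊗-congˡ (⊕-congˡ (⊗-congʳ (con-cong (𝕂.+-identityʳ 1#)))) ⟨
      𝟙 ⊗ (b ⊕ con (1# + 0#) ⊗ a)        ∎
    square-zero-⊕-^ {a} b (suc n) a²≋𝟘 = begin
      (a ⊕ b) ⊗ (a ⊕ b) ^ suc n
        ≈⟨ ⊗-congˡ (square-zero-⊕-^ b n a²≋𝟘) ⟩
      (a ⊕ b) ⊗ (b ^ n ⊗ (b ⊕ con k ⊗ a))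
        ≈⟨ solve 4 (λ a b y k → (a :+ b) :* (y :* (b :+ k :* a)) := (b :* y) :* (b :+ (:1 :+ k) :* a) :+ (a :* a) :* (k :* y))
            ≋-refl a b (b ^ n) (con k) ⟩
      b ^ suc n ⊗ (b ⊕ (𝟙 ⊕ con k) ⊗ a) ⊕ (a ⊗ a) ⊗ (con k ⊗ b ^ n)
        ≈⟨ ⊕-cong (⊗-congˡ (⊕-congˡ (⊗-congʳ (≋-sym (con-+ 1# k))))) (≋𝟘⇒⊗≋𝟘 _ a²≋𝟘) ⟩
      b ^ suc n ⊗ (b ⊕ con (natK K (suc (suc n))) ⊗ a) ⊕ 𝟘
        ≈⟨ ⊕-idʳ _ ⟩
      b ^ suc n ⊗ (b ⊕ con (natK K (suc (suc n))) ⊗ a) ∎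
      where k = natK K (suc n)

    -- Pigeonhole: at most `count p` summands are nonzero, so every monomial of this degree contains
    -- the square of one of them.
    sum-of-square-zero-^ : ∀ {m} (f : Fin m → Term V) (p : Fin m → Bool) → (∀ e → f e ⊗ f e ≋ 𝟘) →
                           (∀ e → p e ≡ false → f e ≋ 𝟘) → ⨁ f ^ suc (count p) ≋ 𝟘
    sum-of-square-zero-^ {zero}  f p sq off = ⊗-zeroˡ 𝟙
    sum-of-square-zero-^ {suc m} f p sq off with p zero in eq
    ... | false = ≋-trans (^-cong (suc n) (≋-trans (⊕-congʳ (off zero eq)) (⊕-idˡ (⨁ (λ e → f (suc e)))))) rest
      where
      n = count (λ e → p (suc e))
      rest = sum-of-square-zero-^ (λ e → f (suc e)) (λ e → p (suc e)) (λ e → sq (suc e)) (λ e → off (suc e))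
    ... | true = ≋-trans (square-zero-⊕-^ (⨁ (λ e → f (suc e))) (suc n) (sq zero)) (≋𝟘⇒⊗≋𝟘 _ rest)
      where
      n = count (λ e → p (suc e))
      rest = sum-of-square-zero-^ (λ e → f (suc e)) (λ e → p (suc e)) (λ e → sq (suc e)) (λ e → off (suc e))

  squares : ∀ {m} → Fin m → Term (Fin m)
  squares e = var e ⊗ var e

  module _ {m : ℕ} where
    open Alg (squares {m})

    square-of-monomial : ∀ k (e : Fin m) → (con k ⊗ var e) ⊗ (con k ⊗ var e) ≋ 𝟘
    square-of-monomial k e = ≋-trans
      (solve 2 (λ k x → (k :* x) :* (k :* x) := (k :* k) :* (x :* x)) ≋-refl (con k) (var e))
      (≋𝟘⇒⊗≋𝟘ʳ _ (relation e))

  -- Graphs on the vertex set Fin k, with loops: contracting an edge from a to b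
  -- redirects to b every edge at a, and leaves a behind as an isolated vertex.
  module _ {k : ℕ} where

    module _ {m : ℕ} (s t : Fin m → Fin k) where

      -- A difference instead of the case distinction in `coeff`: on a loop the two terms cancel,
      -- and the formula is a coboundary when summed against vertex coefficients.
      incidence : Fin k → Fin m → Carrier
      incidence i e = kronecker (s e) i + - kronecker (t e) i

      X′ : Fin k → Term (Fin m)
      X′ i = linear (incidence i)

      cut : (Fin k → Bool) → ℕ
      cut I = count (λ e → I (s e) xor I (t e))

      -- Unlike in the definition of B_G there is a variable for every vertex, and I is arbitrary;
      -- taking I to be all of Fin k gives the relation Σ x_i = 0.
      J : (Fin k → Bool) → Term (Fin k)
      J I = linear (λ i → indicator (I i)) ^ suc (cut I)

      sum-incidence : ∀ (f : Fin k → Carrier) e → sum (λ i → f i * incidence i e) ≈ f (s e) + - f (t e)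
      sum-incidence f e = begin
        sum (λ i → f i * (kronecker (s e) i + - kronecker (t e) i))
          ≈⟨ sum-cong-≋ (λ i → f[x-y]≈fx-fy (f i) (kronecker (s e) i) (kronecker (t e) i)) ⟩
        sum (λ i → f i * kronecker (s e) i + - (f i * kronecker (t e) i))
          ≈⟨ ∑-distrib-+ (λ i → f i * kronecker (s e) i) (λ i → - (f i * kronecker (t e) i)) ⟩
        sum (λ i → f i * kronecker (s e) i) + sum (λ i → - (f i * kronecker (t e) i))
          ≈⟨ 𝕂.+-cong (sum-kronecker f (s e)) (𝕂.trans (sum-neg (λ i → f i * kronecker (t e) i)) (𝕂.-‿cong (sum-kronecker f (t e)))) ⟩
        f (s e) + - f (t e) ∎
        where open Relation.Binary.Reasoning.Setoid 𝕂.setoid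

      -- Exchanging the sums over vertices and edges turns a form into the coboundary of its
      -- coefficients.
      linear[X′] : {R : Set} (rel : R → Term (Fin m)) (α : Fin k → Carrier) →
        Presentation._≋_ rel (linear α [ X′ ]) (linear (λ e → α (s e) + - α (t e)))
      linear[X′] rel α = ≋-trans (linear-linear α incidence var) (lincomb-cong var (sum-incidence α))
        where
        open Alg rel
        open Linear rel

      -- Off the cut the edge coefficients are zero, and `cut I` square-zero summands remain.
      linear[X′]-^ : (I : Fin k → Bool) →
        Presentation._≋_ squares ((linear (λ i → indicator (I i)) [ X′ ]) ^ suc (cut I)) 𝟘
      linear[X′]-^ I = ≋-trans (^-cong (suc (cut I)) (linear[X′] squares (λ i → indicator (I i))))
        (sum-of-square-zero-^ squares _ _ (λ e → square-of-monomial _ e)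
          (λ e not-cut → ≋𝟘⇒⊗≋𝟘 (var e) (con-cong (difference≈0 (I (s e)) (I (t e)) not-cut))))
        where
        open Alg squares
        difference≈0 : ∀ x y → x xor y ≡ false → indicator x + - indicator y ≈ 0#
        difference≈0 true  true  _ = 𝕂.-‿inverseʳ 1#
        difference≈0 false false _ = 𝕂.-‿inverseʳ 0#

      J[X′]≋𝟘 : (I : Fin k → Bool) → Presentation._≋_ squares (J I [ X′ ]) 𝟘
      J[X′]≋𝟘 I = ≋-trans (≋-reflexive (^-substitute (linear (λ i → indicator (I i))) (suc (cut I)) X′)) (linear[X′]-^ I)
        where open Alg squares

  -- Deletion and contraction

  module FirstEdge {k m : ℕ} (s t : Fin (suc m) → Fin k) where

    s′ t′ : Fin m → Fin k
    s′ e = s (suc e)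
    t′ e = t (suc e)

    a b : Fin k
    a = s zero
    b = t zero

    open ConstantDerivation (λ i → incidence s t i zero) public

    module _ where
      open Alg (squares {m})
      open Linear (squares {m})

      delete : Fin (suc m) → Term (Fin m)
      delete zero    = 𝟘
      delete (suc e) = var e

      delete-squares : ∀ e → squares e [ delete ] ≋ 𝟘
      delete-squares zero    = ⊗-zeroˡ 𝟘
      delete-squares (suc e) = relation e

      X′[delete] : ∀ i → X′ s t i [ delete ] ≋ X′ s′ t′ i
      X′[delete] i = ≋-trans (⊕-cong (⊗-zeroʳ _)
        (≋-reflexive (⨁-substitute (λ e → con (incidence s t i (suc e)) ⊗ var (suc e)) delete))) (⊕-idˡ _)

      -- `delete` sets the first edge variable to zero, which leaves the part of p(X) that does not
      -- involve it.
      restrict-to-deletion : ∀ p → Presentation._≋_ squares (p [ X′ s t ]) 𝟘 → p [ X′ s′ t′ ] ≋ 𝟘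
      restrict-to-deletion p p[X′]≋𝟘 = ≋-trans
        (≋-sym (≋-trans (≋-reflexive (substitute-substitute p (X′ s t) delete)) (substitute-pointwise squares p X′[delete])))
        (substitute-cong squares squares delete delete-squares p[X′]≋𝟘)

      ∂φ₀ : Fin (suc m) → Term (Fin m)
      ∂φ₀ e = con (kronecker zero e)

      -- The derivative 2φ of the relation φ² is not zero in the edge algebra, but it vanishes at φ
      -- = 0. This is why the derivation is taken along `delete`.
      ∂φ₀-squares : ∀ e → derive delete ∂φ₀ (squares e) ≋ 𝟘
      ∂φ₀-squares zero    = solve 0 (:0 :* :1 :+ :1 :* :0 := :0) ≋-refl
      ∂φ₀-squares (suc e) = solve 1 (λ x → x :* :0 :+ :0 :* x := :0) ≋-refl (var e)

      ∂-restrict-to-deletion : ∀ p → Presentation._≋_ squares (p [ X′ s t ]) 𝟘 → ∂ p [ X′ s′ t′ ] ≋ 𝟘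
      ∂-restrict-to-deletion p p[X′]≋𝟘 = ≋-trans
        (≋-sym (chain-rule squares p (X′ s t) delete ∂φ₀ (X′ s′ t′) _ X′[delete]
          (λ i → ≋-trans (derive-lincomb delete (kronecker zero) (incidence s t i) (λ e → e))
                         (con-cong (sum-kronecker (incidence s t i) zero)))))
        (derive-cong squares squares delete delete-squares ∂φ₀ ∂φ₀-squares p[X′]≋𝟘)

    open Free {Fin k}
    open Linear (free {Fin k})

    ∂-linear : ∀ α → ∂ (linear α) ≋ con (α a + - α b)
    ∂-linear α = ≋-trans (derive-lincomb var (λ i → incidence s t i zero) α (λ i → i))
      (con-cong (sum-incidence s t α zero))

    module NonLoop (a≢b : a ≢ b) where

      slope-a : incidence s t a zero ≈ 1#
      slope-a = 𝕂.trans (𝕂.+-cong (𝕂.reflexive (kronecker-refl a)) (𝕂.-‿cong (𝕂.reflexive (kronecker-≢ (λ b≡a → a≢b (≡.sym b≡a))))))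
        1-0≈1

      ∂a≋𝟙 : ∂ (var a) ≋ 𝟙
      ∂a≋𝟙 = con-cong slope-a

      -- If the edge has exactly one end in I, then ∂L is 1 or -1, and integration raises the
      -- exponent by the one that the edge adds to the cut. Otherwise ∂L = 0, and it suffices to
      -- integrate the coefficient `q` along `var a`, where ∂ has slope 1.
      antiderivative-of-power : ∀ x y L d q → ∂ L ≋ con (indicator x + - indicator y) →
        ∃ λ w → ∂ (w ⊗ L ^ suc ((if x xor y then 1 else 0) ℕ.+ d)) ≋ q ⊗ L ^ suc d
      antiderivative-of-power true false L d q ∂L = antiderivative
        [1-0]1≈1 ∂L q (suc d)
      antiderivative-of-power false true L d q ∂L = antiderivative
        [0-1][-1]≈1 ∂L q (suc d)
      antiderivative-of-power true  true  L d q ∂L = antiderivative-along-a L d q (≋-trans ∂L (con-cong (𝕂.-‿inverseʳ 1#)))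
        where
        antiderivative-along-a : ∀ L d q → ∂ L ≋ 𝟘 → ∃ λ w → ∂ (w ⊗ L ^ suc d) ≋ q ⊗ L ^ suc d
        antiderivative-along-a L d q ∂L≋𝟘 with antiderivative {var a} (𝕂.*-identityʳ 1#) ∂a≋𝟙 q 0
        ... | w , eq = w ⊗ var a ^ 1 , ≋-trans (∂-⊗-constant (w ⊗ var a ^ 1) (L ^ suc d) (∂-^-constant L (suc d) ∂L≋𝟘))
                                               (⊗-congʳ (≋-trans eq (⊗-idʳ q)))
      antiderivative-of-power false false L d q ∂L = antiderivative-of-power true true L d q
        (≋-trans ∂L (con-cong (𝕂.trans (𝕂.-‿inverseʳ 0#) (𝕂.sym (𝕂.-‿inverseʳ 1#)))))

      antiderivative-of-ideal : ∀ {u} → Ideal (J s′ t′) u → ∃ λ j → Presentation._≋_ (J s t) j 𝟘 × ∂ j ≋ u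
      antiderivative-of-ideal ideal-𝟘 = 𝟘 , Presentation.≋-refl , ≋-refl
      antiderivative-of-ideal (ideal-⊕ x y) with antiderivative-of-ideal x | antiderivative-of-ideal y
      ... | i , i≋𝟘 , ∂i | j , j≋𝟘 , ∂j = i ⊕ j , Alg.⊕≋𝟘 (J s t) i≋𝟘 j≋𝟘 , ⊕-cong ∂i ∂j
      antiderivative-of-ideal (ideal-gen q I)
        with antiderivative-of-power (I a) (I b) (linear (λ i → indicator (I i))) (cut s′ t′ I) q
               (∂-linear (λ i → indicator (I i)))
      ... | w , ∂w = w ⊗ J s t I , Alg.≋𝟘⇒⊗≋𝟘ʳ (J s t) w (Presentation.relation I) , ∂w
      antiderivative-of-ideal (ideal-resp eq x) with antiderivative-of-ideal x
      ... | j , j≋𝟘 , ∂j = j , j≋𝟘 , ≋-trans ∂j eq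

      contract : Fin k → Fin k
      contract v = if does (v ≟ a) then b else v

      contract-a : contract a ≡ b
      contract-a = ≡.cong (if_then b else a) (dec-true (a ≟ a) ≡.refl)

      contract-b : contract b ≡ b
      contract-b = ≡.cong (if_then b else b) (dec-false (b ≟ a) (λ b≡a → a≢b (≡.sym b≡a)))

      s″ t″ : Fin m → Fin k
      s″ e = contract (s′ e)
      t″ e = contract (t′ e)

      -- It sends `var b` to the sum of `var a` and `var b`, `var a` to zero and every other
      -- variable to itself.
      σ : Fin k → Term (Fin k)
      σ i = linear (λ v → kronecker (contract v) i)

      ∂σ≋𝟘 : ∀ i → ∂ (σ i) ≋ 𝟘
      ∂σ≋𝟘 i = ≋-trans (∂-linear (λ v → kronecker (contract v) i)) (con-cong
        (𝕂.trans (𝕂.+-congʳ (𝕂.reflexive (≡.cong (λ v → kronecker v i) (≡.trans contract-a (≡.sym contract-b)))))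
                 (𝕂.-‿inverseʳ _)))

      σ-mod-a : ∀ i → ∃ λ w → var i ≋ σ i ⊕ var a ⊗ w
      σ-mod-a i = con d , (begin
        var i                                                               ≈⟨ lincomb-kronecker i var ⟨
        linear (kronecker i)                                                ≈⟨ lincomb-cong var expand ⟩
        linear (λ v → kronecker (contract v) i + d * kronecker a v)         ≈⟨ lincomb-+ _ _ var ⟩
        σ i ⊕ linear (λ v → d * kronecker a v)                              ≈⟨ ⊕-congˡ (lincomb-* d (kronecker a) var) ⟩
        σ i ⊕ con d ⊗ linear (kronecker a)                                  ≈⟨ ⊕-congˡ (⊗-congˡ (lincomb-kronecker a var)) ⟩
        σ i ⊕ con d ⊗ var a                                                 ≈⟨ ⊕-congˡ (⊗-comm _ _) ⟩
        σ i ⊕ var a ⊗ con d                                                 ∎)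
        where
        open Relation.Binary.Reasoning.Setoid setoid
        -- The difference between `var i` and `σ i` is x_a for i = a, -x_a for i = b and zero
        -- otherwise.
        d = kronecker a i + - kronecker b i
        expand : ∀ v → kronecker i v ≈ kronecker (contract v) i + d * kronecker a v
        expand v with v ≟ a
        ... | yes ≡.refl = 𝕂.trans (𝕂.reflexive (kronecker-sym i a)) (𝕂.trans
          (x≈y+[x-y]1 (kronecker a i) (kronecker b i))
          (𝕂.+-congˡ (𝕂.*-congˡ (𝕂.reflexive (≡.sym (kronecker-refl a))))))
        ... | no v≢a = 𝕂.trans (𝕂.reflexive (kronecker-sym i v)) (𝕂.trans
          (x≈x+y0 (kronecker v i) d)
          (𝕂.+-congˡ (𝕂.*-congˡ (𝕂.reflexive (≡.sym (kronecker-≢ (λ a≡v → v≢a (≡.sym a≡v))))))))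

      -- Contraction adds X_a to X_b and leaves zero at the isolated vertex a, just as `σ` does
      -- before evaluation on the deletion.
      substitute-contraction : ∀ p → Presentation._≋_ (squares {m}) (p [ X′ s″ t″ ]) (p [ σ ] [ X′ s′ t′ ])
      substitute-contraction p = Presentation.≋-trans
        (substitute-pointwise squares p (λ i → Presentation.≋-sym (linear[X′] s′ t′ squares (λ v → kronecker (contract v) i))))
        (Presentation.≋-sym (Alg.≋-reflexive squares (substitute-substitute p σ (X′ s′ t′))))

      -- `σ` carries the form of I to the form of its preimage under `contract`. That preimage has
      -- both ends of the contracted edge on the same side, so the two cuts have the same size.
      J″[σ]≋𝟘 : ∀ I → Presentation._≋_ (J s t) (J s″ t″ I [ σ ]) 𝟘
      J″[σ]≋𝟘 I = Presentation.≋-trans (Alg.≋-reflexive (J s t) (^-substitute (linear (λ i → indicator (I i))) (suc (cut s″ t″ I)) σ))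
        (Presentation.≋-trans (Alg.^-cong (J s t) (suc (cut s″ t″ I)) linear[σ])
          (≡.subst (λ n → Presentation._≋_ (J s t) (linear (λ v → indicator (I (contract v))) ^ suc n) 𝟘)
            cut-contract (Presentation.relation (λ v → I (contract v)))))
        where
        linear[σ] = Presentation.≋-trans (Linear.linear-linear (J s t) (λ i → indicator (I i)) (λ i v → kronecker (contract v) i) var)
          (Linear.lincomb-cong (J s t) var (λ v → sum-kronecker (λ i → indicator (I i)) (contract v)))
        cut-contract : cut s t (λ v → I (contract v)) ≡ cut s″ t″ I
        cut-contract = ≡.cong (λ x → (if x then 1 else 0) ℕ.+ cut s″ t″ I)
          (≡.trans (≡.cong₂ (λ x y → I x xor I y) contract-a contract-b) (xor-same (I b)))

  X′-kernel : ∀ {k} m (s t : Fin m → Fin k) p →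
              Presentation._≋_ squares (p [ X′ s t ]) 𝟘 → Presentation._≋_ (J s t) p 𝟘
  X′-kernel {k} zero s t p p[X′]≋𝟘 = begin
    p                          ≡⟨ substitute-var p ⟨
    p [ var ]                  ≈⟨ substitute-pointwise (J s t) p var≋𝟘 ⟩
    p [ (λ _ → 𝟘) ]            ≡⟨ substitute-substitute p (X′ s t) (λ ()) ⟨
    p [ X′ s t ] [ (λ ()) ]    ≈⟨ substitute-cong (J s t) squares (λ ()) (λ ()) p[X′]≋𝟘 ⟩
    𝟘                          ∎
    where
    open Alg (J s t)
    open Linear (J s t)
    open Relation.Binary.Reasoning.Setoid setoid
    -- Without edges every cut is empty, so the relation of the set {i} has exponent 1 and is the
    -- variable itself.
    var≋𝟘 : ∀ i → var i ≋ 𝟘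
    var≋𝟘 i = begin
      var i                   ≈⟨ lincomb-kronecker i var ⟨
      linear (kronecker i)    ≈⟨ ⊗-idʳ _ ⟨
      J s t (λ v → does (i ≟ v))  ≈⟨ relation (λ v → does (i ≟ v)) ⟩
      𝟘                       ∎
  X′-kernel {k} (suc m) s t p p[X′]≋𝟘 = by-cases (a ≟ b)
    where
    open FirstEdge s t
    open Alg (J s t)
    by-cases : _ → p ≋ 𝟘
    -- A loop lies in no cut, so the graph and its deletion have the same relations.
    by-cases (yes a≡b) = ≡.subst (_≋ 𝟘) (substitute-var p)
      (substitute-cong (J s t) (J s′ t′) var J′≋𝟘 (X′-kernel m s′ t′ p (restrict-to-deletion p p[X′]≋𝟘)))
      where
      J′≋𝟘 : ∀ I → J s′ t′ I [ var ] ≋ 𝟘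
      J′≋𝟘 I = ≡.subst (_≋ 𝟘)
        (≡.trans (≡.cong (λ x → linear (λ i → indicator (I i)) ^ suc ((if x then 1 else 0) ℕ.+ cut s′ t′ I))
                   (≡.trans (≡.cong (λ v → I a xor I v) (≡.sym a≡b)) (xor-same (I a))))
                 (≡.sym (substitute-var (J s′ t′ I))))
        (relation I)
    by-cases (no a≢b) = ≋-trans (⊖≋𝟘⇒≋ r≋𝟘) (proj₁ (proj₂ integral))
      where
      open NonLoop a≢b
      integral = antiderivative-of-ideal (≋𝟘⇒ideal (J s′ t′) (X′-kernel m s′ t′ (∂ p) (∂-restrict-to-deletion p p[X′]≋𝟘)))
      j = proj₁ integral
      r = p ⊖ j
      r-invariant : Presentation._≋_ free r (r [ σ ])
      r-invariant = ∂≋𝟘⇒σ-invariant ∂a≋𝟙 σ ∂σ≋𝟘 σ-mod-a r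
        (Free.≋⇒⊖≋𝟘 (Presentation.≋-sym (proj₂ (proj₂ integral))))
      r[X′]≋𝟘 : Presentation._≋_ squares (r [ X′ s t ]) 𝟘
      r[X′]≋𝟘 = Alg.⊕≋𝟘 squares p[X′]≋𝟘 (Alg.⊝≋𝟘 squares
        (substitute-cong squares (J s t) (X′ s t) (J[X′]≋𝟘 s t) (proj₁ (proj₂ integral))))
      -- Invariance under `σ` turns evaluation on the contraction into evaluation on the deletion,
      -- where `r` vanishes.
      r[X″]≋𝟘 : Presentation._≋_ squares (r [ X′ s″ t″ ]) 𝟘
      r[X″]≋𝟘 = Presentation.≋-trans (substitute-contraction r) (Presentation.≋-trans
        (Presentation.≋-sym (substitute-cong squares free (X′ s′ t′) (λ ()) r-invariant))
        (restrict-to-deletion r r[X′]≋𝟘))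
      r≋𝟘 : r ≋ 𝟘
      r≋𝟘 = ≋-trans (from-free (J s t) r-invariant)
        (substitute-cong (J s t) (J s″ t″) σ J″[σ]≋𝟘 (X′-kernel m s″ t″ r r[X″]≋𝟘))

  -- Exponentials and logarithms of nilpotent elements

  invfact : ℕ → Carrier
  invfact zero    = 1#
  invfact (suc k) = recip k * invfact k

  invfact-suc : ∀ k → natK K (suc k) * invfact (suc k) ≈ invfact k
  invfact-suc k = 𝕂.trans (𝕂.sym (𝕂.*-assoc _ _ _))
    (𝕂.trans (𝕂.*-congʳ (recip-inverse k)) (𝕂.*-identityˡ _))

  invfact-invertible : ∀ k → ∃ λ f → f * invfact k ≈ 1#
  invfact-invertible zero = 1# , 𝕂.*-identityˡ 1#
  invfact-invertible (suc k) with invfact-invertible k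
  ... | f , eq = f * natK K (suc k) , 𝕂.trans (𝕂.*-assoc _ _ _) (𝕂.trans (𝕂.*-congˡ (invfact-suc k)) eq)

  -- Divided powers x^k/k!; in terms of them the binomial theorem is a plain convolution.
  γ : ℕ → Term V → Term V
  γ k x = con (invfact k) ⊗ x ^ k

  partial : (ℕ → Term V) → ℕ → Term V
  partial f zero    = 𝟘
  partial f (suc n) = f zero ⊕ partial (λ k → f (suc k)) n

  convolution : (ℕ → Term V) → (ℕ → Term V) → ℕ → Term V
  convolution f g zero    = f zero ⊗ g zero
  convolution f g (suc n) = f zero ⊗ g (suc n) ⊕ convolution (λ k → f (suc k)) g n

  -- exp N x is the exponential series truncated after x ^ suc N, and
  -- log N k z is the k-th iterate of y ↦ z - higher N y, whose fixed point solves exp N y = 1 + z.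
  quotient higher exp : ℕ → Term V → Term V
  quotient N x = partial (λ k → con (invfact (2 ℕ.+ k)) ⊗ x ^ k) N
  higher   N x = x ⊗ x ⊗ quotient N x
  exp      N x = 𝟙 ⊕ (x ⊕ higher N x)

  log : ℕ → ℕ → Term V → Term V
  log N zero    z = 𝟘
  log N (suc k) z = z ⊖ higher N (log N k z)

  partial-substitute : (f : ℕ → Term V) (h : ℕ → Term W) (g : V → Term W) → (∀ k → f k [ g ] ≡ h k) →
                       ∀ n → partial f n [ g ] ≡ partial h n
  partial-substitute f h g eq zero    = ≡.refl
  partial-substitute f h g eq (suc n) =
    ≡.cong₂ _⊕_ (eq zero) (partial-substitute (λ k → f (suc k)) (λ k → h (suc k)) g (λ k → eq (suc k)) n)

  higher-substitute : ∀ N (x : Term V) (g : V → Term W) → higher N x [ g ] ≡ higher N (x [ g ])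
  higher-substitute N x g = ≡.cong ((x [ g ]) ⊗ (x [ g ]) ⊗_)
    (partial-substitute _ _ g (λ k → ≡.cong (con (invfact (2 ℕ.+ k)) ⊗_) (^-substitute x k g)) N)

  exp-substitute : ∀ N (x : Term V) (g : V → Term W) → exp N x [ g ] ≡ exp N (x [ g ])
  exp-substitute N x g = ≡.cong (λ y → 𝟙 ⊕ ((x [ g ]) ⊕ y)) (higher-substitute N x g)

  log-substitute : ∀ N k (z : Term V) (g : V → Term W) → log N k z [ g ] ≡ log N k (z [ g ])
  log-substitute N zero    z g = ≡.refl
  log-substitute N (suc k) z g = ≡.cong (λ y → (z [ g ]) ⊖ y)
    (≡.trans (higher-substitute N (log N k z) g) (≡.cong (higher N) (log-substitute N k z g)))

  module ExpLog {V R : Set} (rel : R → Term V) where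
    open Alg rel
    open Relation.Binary.Reasoning.Setoid setoid

    -- `exp N` is one polynomial in a single variable, evaluated at its argument.
    exp-cong : ∀ N {x y} → x ≋ y → exp N x ≋ exp N y
    exp-cong N {x} {y} x≋y = ≡.subst₂ _≋_ (exp-substitute N (var tt) (λ _ → x)) (exp-substitute N (var tt) (λ _ → y))
      (substitute-pointwise rel (exp N (var tt)) (λ _ → x≋y))

    log-cong : ∀ N k {x y} → x ≋ y → log N k x ≋ log N k y
    log-cong N k {x} {y} x≋y = ≡.subst₂ _≋_ (log-substitute N k (var tt) (λ _ → x)) (log-substitute N k (var tt) (λ _ → y))
      (substitute-pointwise rel (log N k (var tt)) (λ _ → x≋y))

    partial-cong : ∀ {f g} → (∀ k → f k ≋ g k) → ∀ n → partial f n ≋ partial g n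
    partial-cong f≋g zero    = ≋-refl
    partial-cong f≋g (suc n) = ⊕-cong (f≋g zero) (partial-cong (λ k → f≋g (suc k)) n)

    partial-scale : ∀ a f n → partial (λ k → a ⊗ f k) n ≋ a ⊗ partial f n
    partial-scale a f zero    = ≋-sym (⊗-zeroʳ a)
    partial-scale a f (suc n) =
      ≋-trans (⊕-congˡ (partial-scale a (λ k → f (suc k)) n)) (≋-sym (distribˡ a _ _))

    partial-⊕ : ∀ f g n → partial (λ k → f k ⊕ g k) n ≋ partial f n ⊕ partial g n
    partial-⊕ f g zero    = ≋-sym (⊕-idˡ 𝟘)
    partial-⊕ f g (suc n) = ≋-trans (⊕-congˡ (partial-⊕ (λ k → f (suc k)) (λ k → g (suc k)) n))
      (solve 4 (λ a b x y → (a :+ b) :+ (x :+ y) := (a :+ x) :+ (b :+ y)) ≋-refl (f zero) (g zero) _ _)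

    Vanishes : ℕ → (ℕ → Term V) → Set (c ⊔ ℓ)
    Vanishes M f = ∀ i → M ℕ.≤ i → f i ≋ 𝟘

    vanishes-suc : ∀ {M f} → Vanishes (suc M) f → Vanishes M (λ i → f (suc i))
    vanishes-suc v i M≤i = v (suc i) (ℕ.s≤s M≤i)

    partial-vanishes : ∀ {f} → Vanishes 0 f → ∀ n → partial f n ≋ 𝟘
    partial-vanishes v zero    = ≋-refl
    partial-vanishes v (suc n) = ⊕≋𝟘 (v 0 ℕ.z≤n) (partial-vanishes (λ i _ → v (suc i) ℕ.z≤n) n)

    partial-stable : ∀ {f} M n → Vanishes M f → M ℕ.≤ n → partial f (suc n) ≋ partial f n
    partial-stable zero    n       v _           = ≋-trans (partial-vanishes v (suc n)) (≋-sym (partial-vanishes v n))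
    partial-stable (suc M) (suc n) v (ℕ.s≤s M≤n) = ⊕-congˡ (partial-stable M n (vanishes-suc v) M≤n)

    convolution-congˡ : ∀ {f g} h → (∀ i → f i ≋ g i) → ∀ n → convolution f h n ≋ convolution g h n
    convolution-congˡ h f≋g zero    = ⊗-congʳ (f≋g 0)
    convolution-congˡ h f≋g (suc n) = ⊕-cong (⊗-congʳ (f≋g 0)) (convolution-congˡ h (λ i → f≋g (suc i)) n)

    convolution-congʳ : ∀ f {g h} → (∀ i → g i ≋ h i) → ∀ n → convolution f g n ≋ convolution f h n
    convolution-congʳ f g≋h zero    = ⊗-congˡ (g≋h 0)
    convolution-congʳ f g≋h (suc n) = ⊕-cong (⊗-congˡ (g≋h (suc n))) (convolution-congʳ (λ k → f (suc k)) g≋h n)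

    convolution-⊕ˡ : ∀ f g h n → convolution (λ i → f i ⊕ g i) h n ≋ convolution f h n ⊕ convolution g h n
    convolution-⊕ˡ f g h zero    = solve 3 (λ f g h → (f :+ g) :* h := f :* h :+ g :* h) ≋-refl (f 0) (g 0) (h 0)
    convolution-⊕ˡ f g h (suc n) = ≋-trans (⊕-congˡ (convolution-⊕ˡ (λ k → f (suc k)) (λ k → g (suc k)) h n))
      (solve 5 (λ f g h x y → (f :+ g) :* h :+ (x :+ y) := (f :* h :+ x) :+ (g :* h :+ y))
          ≋-refl (f 0) (g 0) (h (suc n)) _ _)

    convolution-scaleˡ : ∀ a f g n → convolution (λ i → a ⊗ f i) g n ≋ a ⊗ convolution f g n
    convolution-scaleˡ a f g zero    = ⊗-assoc a _ _
    convolution-scaleˡ a f g (suc n) = ≋-trans (⊕-congˡ (convolution-scaleˡ a (λ k → f (suc k)) g n))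
      (solve 4 (λ a f g x → (a :* f) :* g :+ a :* x := a :* (f :* g :+ x)) ≋-refl a (f 0) (g (suc n)) _)

    convolution-scaleʳ : ∀ a f g n → convolution f (λ i → a ⊗ g i) n ≋ a ⊗ convolution f g n
    convolution-scaleʳ a f g zero    = solve 3 (λ a f g → f :* (a :* g) := a :* (f :* g)) ≋-refl a (f 0) (g 0)
    convolution-scaleʳ a f g (suc n) = ≋-trans (⊕-congˡ (convolution-scaleʳ a (λ k → f (suc k)) g n))
      (solve 4 (λ a f g x → f :* (a :* g) :+ a :* x := a :* (f :* g :+ x)) ≋-refl a (f 0) (g (suc n)) _)

    convolution-shiftʳ : ∀ f g → g 0 ≋ 𝟘 → ∀ n → convolution f g (suc n) ≋ convolution f (λ i → g (suc i)) n
    convolution-shiftʳ f g g0≋𝟘 zero    = ≋-trans (⊕-congˡ (≋𝟘⇒⊗≋𝟘ʳ (f 1) g0≋𝟘)) (⊕-idʳ _)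
    convolution-shiftʳ f g g0≋𝟘 (suc n) = ⊕-congˡ (convolution-shiftʳ (λ k → f (suc k)) g g0≋𝟘 n)

    -- On generating series, with f i the coefficient of t^i, this is the operator t d/dt;
    -- `weigh-convolution` is its Leibniz rule.
    weigh : (ℕ → Term V) → ℕ → Term V
    weigh f i = con (natK K i) ⊗ f i

    weigh-suc : ∀ f i → weigh f (suc i) ≋ f (suc i) ⊕ weigh (λ k → f (suc k)) i
    weigh-suc f i = ≋-trans (⊗-congʳ (con-+ 1# (natK K i)))
      (solve 2 (λ n f → (:1 :+ n) :* f := f :+ n :* f) ≋-refl (con (natK K i)) (f (suc i)))

    weigh-convolution : ∀ f g n → weigh (convolution f g) n ≋ convolution (weigh f) g n ⊕ convolution f (weigh g) n
    weigh-convolution f g zero = solve 2 (λ f g → :0 :* (f :* g) := (:0 :* f) :* g :+ f :* (:0 :* g)) ≋-refl (f 0) (g 0)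
    weigh-convolution f g (suc n) = begin
      con N ⊗ (f 0 ⊗ g (suc n) ⊕ C)
        ≈⟨ distribˡ _ _ _ ⟩
      con N ⊗ (f 0 ⊗ g (suc n)) ⊕ con N ⊗ C
        ≈⟨ ⊕-congˡ (≋-trans (⊗-congʳ (con-+ 1# (natK K n))) (solve 2 (λ n c → (:1 :+ n) :* c := c :+ n :* c)
            ≋-refl (con (natK K n)) C)) ⟩
      con N ⊗ (f 0 ⊗ g (suc n)) ⊕ (C ⊕ con (natK K n) ⊗ C)
        ≈⟨ ⊕-congˡ (⊕-congˡ (weigh-convolution f⁺ g n)) ⟩
      con N ⊗ (f 0 ⊗ g (suc n)) ⊕ (C ⊕ (convolution (weigh f⁺) g n ⊕ convolution f⁺ (weigh g) n))
        ≈⟨ solve 6 (λ n f g c x y → n :* (f :* g) :+ (c :+ (x :+ y)) := ((:0 :* f) :* g :+ (c :+ x)) :+ (f :* (n :* g) :+ y))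
            ≋-refl (con N) (f 0) (g (suc n)) C _ _ ⟩
      (weigh f 0 ⊗ g (suc n) ⊕ (C ⊕ convolution (weigh f⁺) g n)) ⊕ convolution f (weigh g) (suc n)
        ≈⟨ ⊕-congʳ (⊕-congˡ (convolution-⊕ˡ f⁺ (weigh f⁺) g n)) ⟨
      (weigh f 0 ⊗ g (suc n) ⊕ convolution (λ i → f⁺ i ⊕ weigh f⁺ i) g n) ⊕ convolution f (weigh g) (suc n)
        ≈⟨ ⊕-congʳ (⊕-congˡ (convolution-congˡ g (weigh-suc f) n)) ⟨
      convolution (weigh f) g (suc n) ⊕ convolution f (weigh g) (suc n) ∎
      where
      N  = natK K (suc n)
      f⁺ = λ k → f (suc k)
      C  = convolution f⁺ g n

    -- The differential equation of exp(xt), read on coefficients.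
    weigh-γ : ∀ x n → weigh (λ k → γ k x) (suc n) ≋ x ⊗ γ n x
    weigh-γ x n = begin
      con (natK K (suc n)) ⊗ (con (invfact (suc n)) ⊗ (x ⊗ x ^ n))
        ≈⟨ solve 4 (λ a b x y → a :* (b :* (x :* y)) := x :* ((a :* b) :* y))
            ≋-refl (con (natK K (suc n))) (con (invfact (suc n))) x (x ^ n) ⟩
      x ⊗ ((con (natK K (suc n)) ⊗ con (invfact (suc n))) ⊗ x ^ n)
        ≈⟨ ⊗-congˡ (⊗-congʳ (≋-trans (≋-sym (con-* _ _)) (con-cong (invfact-suc n)))) ⟩
      x ⊗ γ n x ∎

    weigh-cancel : ∀ n {a b} → con (natK K (suc n)) ⊗ a ≋ con (natK K (suc n)) ⊗ b → a ≋ b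
    weigh-cancel n {a} {b} p = ≋-trans (≋-sym (cancel a)) (≋-trans (⊗-congˡ p) (cancel b))
      where
      cancel : ∀ a → con (recip n) ⊗ (con (natK K (suc n)) ⊗ a) ≋ a
      cancel a = begin
        con (recip n) ⊗ (con (natK K (suc n)) ⊗ a)  ≈⟨ solve 3 (λ r k a → r :* (k :* a) := (k :* r) :* a)
            ≋-refl (con (recip n)) (con (natK K (suc n))) a ⟩
        con (natK K (suc n)) ⊗ con (recip n) ⊗ a    ≈⟨ ⊗-congʳ (≋-trans (≋-sym (con-* _ _)) (con-cong (recip-inverse n))) ⟩
        𝟙 ⊗ a                                       ≈⟨ ⊗-idˡ a ⟩
        a                                           ∎

    -- Both sides satisfy (n+1) c_(n+1) = (x + y) c_n, the right one by the Leibniz rule for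
    -- `weigh`; dividing by n + 1 completes the induction.
    γ-⊕ : ∀ x y n → γ n (x ⊕ y) ≋ convolution (λ k → γ k x) (λ k → γ k y) n
    γ-⊕ x y zero    = solve 0 (:1 :* :1 := (:1 :* :1) :* (:1 :* :1)) ≋-refl
    γ-⊕ x y (suc n) = weigh-cancel n (begin
      weigh (λ k → γ k (x ⊕ y)) (suc n)
        ≈⟨ weigh-γ (x ⊕ y) n ⟩
      (x ⊕ y) ⊗ γ n (x ⊕ y)
        ≈⟨ ⊗-congˡ (γ-⊕ x y n) ⟩
      (x ⊕ y) ⊗ convolution γx γy n
        ≈⟨ solve 3 (λ x y c → (x :+ y) :* c := x :* c :+ y :* c) ≋-refl x y _ ⟩
      x ⊗ convolution γx γy n ⊕ y ⊗ convolution γx γy n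
        ≈⟨ ⊕-cong (convolution-scaleˡ x γx γy n) (convolution-scaleʳ y γx γy n) ⟨
      convolution (λ k → x ⊗ γx k) γy n ⊕ convolution γx (λ k → y ⊗ γy k) n
        ≈⟨ ⊕-cong (convolution-congˡ γy (weigh-γ x) n) (convolution-congʳ γx (weigh-γ y) n) ⟨
      convolution (λ k → weigh γx (suc k)) γy n ⊕ convolution γx (λ k → weigh γy (suc k)) n
        ≈⟨ ⊕-cong (solve 3 (λ g y c → (:0 :* g) :* y :+ c := c)
            ≋-refl (γx 0) (γy (suc n)) _) (convolution-shiftʳ γx (weigh γy) (⊗-zeroˡ _) n) ⟨
      convolution (weigh γx) γy (suc n) ⊕ convolution γx (weigh γy) (suc n)
        ≈⟨ weigh-convolution γx γy (suc n) ⟨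
      weigh (convolution γx γy) (suc n) ∎)
      where
      γx = λ k → γ k x
      γy = λ k → γ k y

    convolution-vanishesˡ : ∀ f g → Vanishes 0 f → ∀ n → convolution f g n ≋ 𝟘
    convolution-vanishesˡ f g v zero    = ≋𝟘⇒⊗≋𝟘 _ (v 0 ℕ.z≤n)
    convolution-vanishesˡ f g v (suc n) =
      ⊕≋𝟘 (≋𝟘⇒⊗≋𝟘 _ (v 0 ℕ.z≤n)) (convolution-vanishesˡ (λ k → f (suc k)) g (λ i _ → v (suc i) ℕ.z≤n) n)

    convolution-vanishes : ∀ M L f g → Vanishes M f → Vanishes L g → Vanishes (M ℕ.+ L) (convolution f g)
    convolution-vanishes zero    L f g vf vg n       _             = convolution-vanishesˡ f g vf n
    convolution-vanishes (suc M) L f g vf vg (suc n) (ℕ.s≤s M+L≤n) = ⊕≋𝟘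
      (≋𝟘⇒⊗≋𝟘ʳ _ (vg (suc n) (ℕ.m≤n⇒m≤1+n (ℕ.≤-trans (ℕ.m≤n+m L M) M+L≤n))))
      (convolution-vanishes M L (λ k → f (suc k)) g (vanishes-suc vf) vg n M+L≤n)

    -- The Cauchy product loses nothing to truncation: `f` has no terms from M on and `g` none from
    -- L on, so no nonzero product reaches degree M + N.
    partial-convolution : ∀ M {L N} f g → Vanishes M f → Vanishes L g → L ℕ.≤ N →
      partial (convolution f g) (M ℕ.+ N) ≋ partial f (M ℕ.+ N) ⊗ partial g (M ℕ.+ N)
    partial-convolution zero {L} {N} f g vf vg L≤N = ≋-trans
      (partial-vanishes (λ i _ → convolution-vanishesˡ f g vf i) N) (≋-sym (≋𝟘⇒⊗≋𝟘 _ (partial-vanishes vf N)))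
    partial-convolution (suc M) {L} {N} f g vf vg L≤N = begin
      f 0 ⊗ g 0 ⊕ partial (λ n → f 0 ⊗ g (suc n) ⊕ convolution f⁺ g n) (M ℕ.+ N)
        ≈⟨ ⊕-congˡ (partial-⊕ (λ n → f 0 ⊗ g (suc n)) (convolution f⁺ g) (M ℕ.+ N)) ⟩
      f 0 ⊗ g 0 ⊕ (partial (λ n → f 0 ⊗ g (suc n)) (M ℕ.+ N) ⊕ partial (convolution f⁺ g) (M ℕ.+ N))
        ≈⟨ ⊕-congˡ (⊕-cong (partial-scale (f 0) (λ n → g (suc n)) (M ℕ.+ N)) (partial-convolution M f⁺ g (vanishes-suc vf) vg L≤N)) ⟩
      f 0 ⊗ g 0 ⊕ (f 0 ⊗ partial (λ n → g (suc n)) (M ℕ.+ N) ⊕ partial f⁺ (M ℕ.+ N) ⊗ partial g (M ℕ.+ N))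
        -- `g` vanishes at index M + N, so its partial sum may be lengthened by one term.
        ≈⟨ ⊕-congˡ (⊕-congˡ (⊗-congˡ (partial-stable L (M ℕ.+ N) vg (ℕ.≤-trans L≤N (ℕ.m≤n+m N M))))) ⟨
      f 0 ⊗ g 0 ⊕ (f 0 ⊗ partial (λ n → g (suc n)) (M ℕ.+ N) ⊕ partial f⁺ (M ℕ.+ N) ⊗ partial g (suc (M ℕ.+ N)))
        ≈⟨ solve 4 (λ f g h i → f :* g :+ (f :* h :+ i :* (g :+ h)) := (f :+ i) :* (g :+ h)) ≋-refl (f 0) (g 0) _ _ ⟩
      (f 0 ⊕ partial f⁺ (M ℕ.+ N)) ⊗ partial g (suc (M ℕ.+ N)) ∎
      where f⁺ = λ k → f (suc k)

    γ-vanishes : ∀ {M x} → x ^ M ≋ 𝟘 → Vanishes M (λ k → γ k x)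
    γ-vanishes x^M≋𝟘 i M≤i = ≋𝟘⇒⊗≋𝟘ʳ _ (^-vanishes-above M≤i x^M≋𝟘)

    -- In total degree M + L every term has degree at least M in x or at least L in y. The factorial
    -- returns from divided powers to powers.
    ⊕-nilpotent : ∀ {x y} M L → x ^ M ≋ 𝟘 → y ^ L ≋ 𝟘 → (x ⊕ y) ^ (M ℕ.+ L) ≋ 𝟘
    ⊕-nilpotent {x} {y} M L x^M≋𝟘 y^L≋𝟘 with invfact-invertible (M ℕ.+ L)
    ... | f , f-inverse = begin
      (x ⊕ y) ^ (M ℕ.+ L)                  ≈⟨ ⊗-idˡ _ ⟨
      𝟙 ⊗ (x ⊕ y) ^ (M ℕ.+ L)              ≈⟨ ⊗-congʳ (≋-trans (≋-sym (con-* _ _)) (con-cong f-inverse)) ⟨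
      con f ⊗ con (invfact (M ℕ.+ L)) ⊗ (x ⊕ y) ^ (M ℕ.+ L)  ≈⟨ ⊗-assoc _ _ _ ⟩
      con f ⊗ γ (M ℕ.+ L) (x ⊕ y)          ≈⟨ ⊗-congˡ (γ-⊕ x y (M ℕ.+ L)) ⟩
      con f ⊗ convolution (λ k → γ k x) (λ k → γ k y) (M ℕ.+ L)
        ≈⟨ ≋𝟘⇒⊗≋𝟘ʳ _ (convolution-vanishes M L _ _ (γ-vanishes x^M≋𝟘) (γ-vanishes y^L≋𝟘) (M ℕ.+ L) ℕ.≤-refl) ⟩
      𝟘 ∎

    -- Exponential and logarithm at a fixed truncation

    module _ (N : ℕ) where

      exp≋partial : ∀ x → exp N x ≋ partial (λ k → γ k x) (2 ℕ.+ N)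
      exp≋partial x = ≋-sym (⊕-cong (⊗-idˡ 𝟙) (⊕-cong
        (≋-trans (⊗-congʳ (con-cong invfact-1)) (solve 1 (λ x → :1 :* (x :* :1) := x) ≋-refl x))
        (≋-trans (partial-cong (λ k → solve 3 (λ c x y → c :* (x :* (x :* y)) := (x :* x) :* (c :* y))
            ≋-refl (con (invfact (2 ℕ.+ k))) x (x ^ k)) N)
                 (partial-scale (x ⊗ x) (λ k → con (invfact (2 ℕ.+ k)) ⊗ x ^ k) N))))
        where
        invfact-1 : invfact 1 ≈ 1#
        invfact-1 = 𝕂.trans (𝕂.sym (𝕂.*-identityˡ _)) (𝕂.trans (𝕂.*-congʳ (𝕂.sym (𝕂.+-identityʳ 1#))) (invfact-suc 0))

      exp-⊕ : ∀ {x y} M L → x ^ M ≋ 𝟘 → y ^ L ≋ 𝟘 → M ℕ.+ L ℕ.≤ 2 ℕ.+ N → exp N (x ⊕ y) ≋ exp N x ⊗ exp N y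
      exp-⊕ {x} {y} M L x^M≋𝟘 y^L≋𝟘 M+L≤ with ℕ.m≤n⇒∃[o]m+o≡n M+L≤
      ... | o , M+L+o≡ = begin
        exp N (x ⊕ y)                                                 ≈⟨ exp≋partial (x ⊕ y) ⟩
        partial (λ k → γ k (x ⊕ y)) (2 ℕ.+ N)                         ≈⟨ partial-cong (γ-⊕ x y) (2 ℕ.+ N) ⟩
        partial (convolution (λ k → γ k x) (λ k → γ k y)) (2 ℕ.+ N)
          ≈⟨ ≡.subst (λ n → partial (convolution (λ k → γ k x) (λ k → γ k y)) n ≋ partial (λ k → γ k x) n ⊗ partial (λ k → γ k y) n)
               (≡.trans (≡.sym (ℕ.+-assoc M L o)) M+L+o≡)
               (partial-convolution M _ _ (γ-vanishes x^M≋𝟘) (γ-vanishes y^L≋𝟘) (ℕ.m≤m+n L o)) ⟩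
        partial (λ k → γ k x) (2 ℕ.+ N) ⊗ partial (λ k → γ k y) (2 ℕ.+ N)
          ≈⟨ ⊗-cong (exp≋partial x) (exp≋partial y) ⟨
        exp N x ⊗ exp N y ∎

      -- Nilpotency is proved alongside because `exp-⊕` needs the number 2 + N of terms to be at
      -- least the sum of the two orders. The `suc` serves the empty sum, which needs exponent 1.
      exp-⨁ : ∀ {k} (f : Fin k → Term V) d → (∀ i → f i ^ d ≋ 𝟘) → suc (k ℕ.* d) ℕ.≤ 2 ℕ.+ N →
              ⨁ f ^ suc (k ℕ.* d) ≋ 𝟘 × exp N (⨁ f) ≋ ⨂ (λ i → exp N (f i))
      exp-⨁ {zero}  f d f^d≋𝟘 _ = ⊗-zeroˡ 𝟙 ,
        solve 1 (λ q → :1 :+ (:0 :+ :0 :* :0 :* q) := :1) ≋-refl (quotient N 𝟘)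
      exp-⨁ {suc k} f d f^d≋𝟘 bound with exp-⨁ (λ i → f (suc i)) d (λ i → f^d≋𝟘 (suc i))
                                          (ℕ.≤-trans (ℕ.s≤s (ℕ.m≤n+m (k ℕ.* d) d)) bound)
      ... | nil , eq =
        ≡.subst (λ n → ⨁ f ^ n ≋ 𝟘) (ℕ.+-suc d (k ℕ.* d)) (⊕-nilpotent d (suc (k ℕ.* d)) (f^d≋𝟘 zero) nil) ,
        ≋-trans (exp-⊕ d (suc (k ℕ.* d)) (f^d≋𝟘 zero) nil (≡.subst (ℕ._≤ 2 ℕ.+ N) (≡.sym (ℕ.+-suc d (k ℕ.* d))) bound))
                (⊗-congˡ eq)

      exp-square-zero : ∀ {x} → x ⊗ x ≋ 𝟘 → exp N x ≋ 𝟙 ⊕ x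
      exp-square-zero {x} x²≋𝟘 = ⊕-congˡ (≋-trans (⊕-congˡ (≋𝟘⇒⊗≋𝟘 _ x²≋𝟘)) (⊕-idʳ x))

      quotient-difference : ∀ a b → ∃ λ s → quotient N a ≋ quotient N b ⊕ (a ⊖ b) ⊗ s
      quotient-difference a b = partial-difference (λ k → con (invfact (2 ℕ.+ k)) ⊗ a ^ k) (λ k → con (invfact (2 ℕ.+ k)) ⊗ b ^ k) term-difference N
        where
        power-difference : ∀ k → ∃ λ s → a ^ k ≋ b ^ k ⊕ (a ⊖ b) ⊗ s
        power-difference zero = 𝟘 , solve 2 (λ a b → :1 := :1 :+ (a :- b) :* :0) ≋-refl a b
        power-difference (suc k) with power-difference k
        ... | s , eq = b ^ k ⊕ a ⊗ s , ≋-trans (⊗-congˡ eq)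
          (solve 4 (λ a b y s → a :* (y :+ (a :- b) :* s) := b :* y :+ (a :- b) :* (y :+ a :* s)) ≋-refl a b (b ^ k) s)
        term-difference : ∀ k → ∃ λ s → con (invfact (2 ℕ.+ k)) ⊗ a ^ k ≋ con (invfact (2 ℕ.+ k)) ⊗ b ^ k ⊕ (a ⊖ b) ⊗ s
        term-difference k with power-difference k
        ... | s , eq = con (invfact (2 ℕ.+ k)) ⊗ s , ≋-trans (⊗-congˡ eq)
          (solve 4 (λ c y d s → c :* (y :+ d :* s) := c :* y :+ d :* (c :* s))
              ≋-refl (con (invfact (2 ℕ.+ k))) (b ^ k) (a ⊖ b) s)
        partial-difference : ∀ f g → (∀ k → ∃ λ s → f k ≋ g k ⊕ (a ⊖ b) ⊗ s) →
                             ∀ n → ∃ λ s → partial f n ≋ partial g n ⊕ (a ⊖ b) ⊗ s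
        partial-difference f g h zero = 𝟘 , solve 1 (λ d → :0 := :0 :+ d :* :0) ≋-refl (a ⊖ b)
        partial-difference f g h (suc n) with h 0 | partial-difference (λ k → f (suc k)) (λ k → g (suc k)) (λ k → h (suc k)) n
        ... | s , p | u , q = s ⊕ u , ≋-trans (⊕-cong p q)
          (solve 5 (λ x d s y u → (x :+ d :* s) :+ (y :+ d :* u) := (x :+ y) :+ d :* (s :+ u)) ≋-refl (g 0) (a ⊖ b) s _ u)

      -- `higher` starts in degree two, so its difference quotient at two multiples of z is again a
      -- multiple of z. Hence the iteration defining `log` contracts z-adically.
      higher-difference : ∀ {z a b α β} → a ≋ z ⊗ α → b ≋ z ⊗ β →
                          ∃ λ s → higher N a ≋ higher N b ⊕ (a ⊖ b) ⊗ (z ⊗ s)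
      higher-difference {z} {a} {b} {α} {β} a≋zα b≋zβ with quotient-difference a b
      ... | s , eq = (α ⊕ β) ⊗ q ⊕ α ⊗ a ⊗ s , (begin
        a ⊗ a ⊗ quotient N a
          ≈⟨ ⊗-congˡ eq ⟩
        a ⊗ a ⊗ (q ⊕ (a ⊖ b) ⊗ s)
          ≈⟨ solve 4 (λ a b q s → a :* a :* (q :+ (a :- b) :* s) := b :* b :* q :+ (a :- b) :* ((a :+ b) :* q :+ a :* a :* s))
              ≋-refl a b q s ⟩
        b ⊗ b ⊗ q ⊕ (a ⊖ b) ⊗ ((a ⊕ b) ⊗ q ⊕ a ⊗ a ⊗ s)
          ≈⟨ ⊕-congˡ (⊗-congˡ (⊕-cong (⊗-congʳ (⊕-cong a≋zα b≋zβ)) (⊗-congʳ (⊗-congʳ a≋zα)))) ⟩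
        b ⊗ b ⊗ q ⊕ (a ⊖ b) ⊗ ((z ⊗ α ⊕ z ⊗ β) ⊗ q ⊕ z ⊗ α ⊗ a ⊗ s)
          ≈⟨ ⊕-congˡ (⊗-congˡ (solve 6 (λ z α β q a s → (z :* α :+ z :* β) :* q :+ z :* α :* a :* s := z :* ((α :+ β) :* q :+ α :* a :* s))
              ≋-refl z α β q a s)) ⟩
        b ⊗ b ⊗ q ⊕ (a ⊖ b) ⊗ (z ⊗ ((α ⊕ β) ⊗ q ⊕ α ⊗ a ⊗ s)) ∎)
        where q = quotient N b

      log-divisible : ∀ k z → ∃ λ s → log N k z ≋ z ⊗ s
      log-divisible zero    z = 𝟘 , ≋-sym (⊗-zeroʳ z)
      log-divisible (suc k) z with log-divisible k z
      ... | s , eq = 𝟙 ⊖ (s ⊗ log N k z ⊗ q) , (begin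
        z ⊖ (log N k z ⊗ log N k z ⊗ q)   ≈⟨ ⊕-congˡ (⊝-cong (⊗-congʳ (⊗-congʳ eq))) ⟩
        z ⊖ (z ⊗ s ⊗ log N k z ⊗ q)       ≈⟨ solve 4 (λ z s l q → z :- z :* s :* l :* q := z :* (:1 :- s :* l :* q))
            ≋-refl z s (log N k z) q ⟩
        z ⊗ (𝟙 ⊖ (s ⊗ log N k z ⊗ q))     ∎)
        where q = quotient N (log N k z)

      -- Each iterate gains one power of z by `higher-difference`; for nilpotent z the iteration
      -- becomes stationary.
      log-step : ∀ k z → ∃ λ s → log N (suc k) z ≋ log N k z ⊕ z ^ suc k ⊗ s
      log-step zero z = 𝟙 , solve 2 (λ z q → z :- :0 :* :0 :* q := :0 :+ (z :* :1) :* :1) ≋-refl z (quotient N 𝟘)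
      log-step (suc k) z = ⊝ (proj₁ step ⊗ proj₁ diff) , propagate (proj₂ step) (proj₂ diff)
        where
        step = log-step k z
        diff = higher-difference (proj₂ (log-divisible (suc k) z)) (proj₂ (log-divisible k z))
        propagate : ∀ {y h h′ l l′ s u} → l′ ≋ l ⊕ y ⊗ s → h′ ≋ h ⊕ (l′ ⊖ l) ⊗ (z ⊗ u) →
                    z ⊖ h′ ≋ (z ⊖ h) ⊕ z ⊗ y ⊗ (⊝ (s ⊗ u))
        propagate {y} {h} {h′} {l} {l′} {s} {u} p q =
          ≋-trans (⊕-congˡ (⊝-cong (≋-trans q (⊕-congˡ (⊗-congʳ (⊕-congʳ p))))))
            (solve 6 (λ z h l y s u → z :- (h :+ ((l :+ y :* s) :- l) :* (z :* u)) := (z :- h) :+ (z :* y) :* (:- (s :* u)))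
                ≋-refl z h l y s u)

      exp-log : ∀ k {z} → z ^ k ≋ 𝟘 → exp N (log N k z) ≋ 𝟙 ⊕ z
      exp-log k {z} z^k≋𝟘 = ⊕-congˡ (fixed (≋-trans (proj₂ (log-step k z))
        (≋-trans (⊕-congˡ (≋𝟘⇒⊗≋𝟘 _ (≋𝟘⇒⊗≋𝟘ʳ z z^k≋𝟘))) (⊕-idʳ _))))
        where
        fixed : ∀ {l h} → z ⊖ h ≋ l → l ⊕ h ≋ z
        fixed {l} {h} p = ≋-trans (⊕-congʳ (≋-sym p)) (solve 2 (λ z h → (z :- h) :+ h := z) ≋-refl z h)

      exp-1-divisible : ∀ x → exp N x ⊖ 𝟙 ≋ x ⊗ (𝟙 ⊕ x ⊗ quotient N x)
      exp-1-divisible x = solve 2 (λ x q → (:1 :+ (x :+ x :* x :* q)) :- :1 := x :* (:1 :+ x :* q)) ≋-refl x (quotient N x)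

      -- The difference u of x and log (exp x) satisfies u = u x s for some s, so u = u (x s)^k = 0.
      log-exp : ∀ k {x} → x ^ k ≋ 𝟘 → log N k (exp N x ⊖ 𝟙) ≋ x
      log-exp k {x} x^k≋𝟘 = ⊖≋𝟘⇒≋ (≋-trans (iterate (fixed same-exp (proj₂ diff)) k)
        (≋𝟘⇒⊗≋𝟘ʳ _ (^-vanishes-⊗ k ≋-refl x^k≋𝟘)))
        where
        l-div = log-divisible k (exp N x ⊖ 𝟙)
        diff = higher-difference {x} {x} {log N k (exp N x ⊖ 𝟙)} (≋-sym (⊗-idʳ x))
          (≋-trans (proj₂ l-div) (≋-trans (⊗-congʳ (exp-1-divisible x)) (⊗-assoc x _ (proj₁ l-div))))
        cancel : ∀ e → 𝟙 ⊕ (e ⊖ 𝟙) ≋ e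
        cancel = solve 1 (λ e → :1 :+ (e :- :1) := e) ≋-refl
        same-exp : exp N (log N k (exp N x ⊖ 𝟙)) ≋ exp N x
        same-exp = ≋-trans (exp-log k (^-vanishes-⊗ k (exp-1-divisible x) x^k≋𝟘)) (cancel (exp N x))
        fixed : ∀ {l h h′ s} → 𝟙 ⊕ (l ⊕ h) ≋ 𝟙 ⊕ (x ⊕ h′) → h′ ≋ h ⊕ (x ⊖ l) ⊗ (x ⊗ s) →
                l ⊖ x ≋ (l ⊖ x) ⊗ (x ⊗ (⊝ s))
        fixed {l} {h} {h′} {s} p q = begin
          l ⊖ x
            ≈⟨ solve 3 (λ l h x → l :- x := (:1 :+ (l :+ h)) :- (:1 :+ (x :+ h))) ≋-refl l h x ⟩
          (𝟙 ⊕ (l ⊕ h)) ⊖ (𝟙 ⊕ (x ⊕ h))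
            ≈⟨ ⊕-congʳ (≋-trans p (⊕-congˡ (⊕-congˡ q))) ⟩
          (𝟙 ⊕ (x ⊕ (h ⊕ (x ⊖ l) ⊗ (x ⊗ s)))) ⊖ (𝟙 ⊕ (x ⊕ h))
            ≈⟨ solve 4 (λ l h x s → (:1 :+ (x :+ (h :+ (x :- l) :* (x :* s)))) :- (:1 :+ (x :+ h)) := (l :- x) :* (x :* (:- s)))
                ≋-refl l h x s ⟩
          (l ⊖ x) ⊗ (x ⊗ (⊝ s)) ∎
        iterate : ∀ {u v} → u ≋ u ⊗ v → ∀ k → u ≋ u ⊗ v ^ k
        iterate {u} p zero    = ≋-sym (⊗-idʳ u)
        iterate {u} {v} p (suc k) = ≋-trans p (≋-trans (⊗-congʳ (iterate p k)) (≋-trans (⊗-assoc u _ v) (⊗-congˡ (⊗-comm _ v))))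

      -- Any nilpotency order k makes `log-exp` available, which exhibits x as a multiple of exp x -
      -- 1; the sharp exponent d is then inherited.
      ^-vanishes-exp : ∀ k d {x} → x ^ k ≋ 𝟘 → (exp N x ⊖ 𝟙) ^ d ≋ 𝟘 → x ^ d ≋ 𝟘
      ^-vanishes-exp k d {x} x^k≋𝟘 = ^-vanishes-⊗ d
        (≋-trans (≋-sym (log-exp k x^k≋𝟘)) (proj₂ (log-divisible k (exp N x ⊖ 𝟙))))

  -- The four algebras

  -- `KAlgebra` carries operations without axioms, so inverting and composing isomorphisms requires
  -- these laws separately.
  record Lawful {a ℓa} (P : KAlgebra a ℓa) : Set (a ⊔ ℓa) where
    open KAlgebra P
    field
      ≈-sym   : ∀ {x y} → x ≈A y → y ≈A x
      ≈-trans : ∀ {x y z} → x ≈A y → y ≈A z → x ≈A z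
      +-cong  : ∀ {x x′ y y′} → x ≈A x′ → y ≈A y′ → (x +A y) ≈A (x′ +A y′)
      *-cong  : ∀ {x x′ y y′} → x ≈A x′ → y ≈A y′ → (x *A y) ≈A (x′ *A y′)

  presentation-lawful : {V R : Set} (rel : R → Term V) → Lawful (Presentation.algebra rel)
  presentation-lawful rel = record { ≈-sym = ≋-sym ; ≈-trans = ≋-trans ; +-cong = ⊕-cong ; *-cong = ⊗-cong }
    where open Presentation rel

  subalgebra-lawful : {U V R : Set} (rel : R → Term V) (gen : U → Term V) → Lawful (Presentation.subalgebra rel gen)
  subalgebra-lawful rel gen = record { ≈-sym = ≋-sym ; ≈-trans = ≋-trans ; +-cong = ⊕-cong ; *-cong = ⊗-cong }
    where open Presentation rel

  ≅-sym : ∀ {a ℓa b ℓb} {P : KAlgebra a ℓa} {Q : KAlgebra b ℓb} → Lawful P → Lawful Q → P ≅ Q → Q ≅ P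
  ≅-sym LP LQ f = record
    { to = from ; from = to ; to-cong = from-cong ; from-cong = to-cong
    ; to-+ = λ x y → P.≈-trans
        (from-cong (Q.≈-trans (Q.+-cong (Q.≈-sym (to∘from x)) (Q.≈-sym (to∘from y))) (Q.≈-sym (to-+ _ _)))) (from∘to _)
    ; to-* = λ x y → P.≈-trans
        (from-cong (Q.≈-trans (Q.*-cong (Q.≈-sym (to∘from x)) (Q.≈-sym (to∘from y))) (Q.≈-sym (to-* _ _)))) (from∘to _)
    ; to-ι = λ k → P.≈-trans (from-cong (Q.≈-sym (to-ι k))) (from∘to _)
    ; to∘from = from∘to ; from∘to = to∘from
    }
    where
    module P = Lawful LP
    module Q = Lawful LQ
    open _≅_ f

  ≅-trans : ∀ {a ℓa b ℓb d ℓd} {P : KAlgebra a ℓa} {Q : KAlgebra b ℓb} {T : KAlgebra d ℓd} →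
            Lawful P → Lawful T → P ≅ Q → Q ≅ T → P ≅ T
  ≅-trans LP LT f g = record
    { to = λ x → g.to (f.to x) ; from = λ y → f.from (g.from y)
    ; to-cong = λ p → g.to-cong (f.to-cong p) ; from-cong = λ p → f.from-cong (g.from-cong p)
    ; to-+ = λ x y → T.≈-trans (g.to-cong (f.to-+ x y)) (g.to-+ _ _)
    ; to-* = λ x y → T.≈-trans (g.to-cong (f.to-* x y)) (g.to-* _ _)
    ; to-ι = λ k → T.≈-trans (g.to-cong (f.to-ι k)) (g.to-ι k)
    ; to∘from = λ y → T.≈-trans (g.to-cong (f.to∘from _)) (g.to∘from y)
    ; from∘to = λ x → P.≈-trans (f.from-cong (g.from∘to _)) (f.from∘to x)
    }
    where
    module P = Lawful LP
    module T = Lawful LT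
    module f = _≅_ f
    module g = _≅_ g

  -- Presented algebras against subalgebras

  module _ {V R : Set} (rel : R → Term V) where
    open Alg rel

    -- The inverse reads off the expression stored with an element. Two expressions of the same
    -- element differ by a polynomial in the kernel, hence by a consequence of the relations.
    presentation≅subalgebra : {U S : Set} (rel′ : S → Term U) (gen : U → Term V) → (∀ r → rel′ r [ gen ] ≋ 𝟘) →
      (∀ p → p [ gen ] ≋ 𝟘 → Presentation._≋_ rel′ p 𝟘) → Presentation.algebra rel′ ≅ subalgebra gen
    presentation≅subalgebra rel′ gen holds kernel = record
      { to = λ p → sub (p [ gen ]) p ≋-refl
      ; from = Sub.expr
      ; to-cong = substitute-cong rel rel′ gen holds
      ; from-cong = λ {x} {y} eq → Alg.⊖≋𝟘⇒≋ rel′ (kernel (Sub.expr x ⊖ Sub.expr y)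
          (≋⇒⊖≋𝟘 (≋-trans (Sub.witness x) (≋-trans eq (≋-sym (Sub.witness y))))))
      ; to-+ = λ _ _ → ≋-refl
      ; to-* = λ _ _ → ≋-refl
      ; to-ι = λ _ → ≋-refl
      ; to∘from = Sub.witness
      ; from∘to = λ _ → Presentation.≋-refl
      }

    -- Two generating families of the same subalgebra: elements stay as they are, and only the
    -- stored expressions are rewritten.
    subalgebra≅subalgebra : {U U′ : Set} (gen : U → Term V) (gen′ : U′ → Term V) (e : U → Term U′) (e′ : U′ → Term U) →
      (∀ u → e u [ gen′ ] ≋ gen u) → (∀ u → e′ u [ gen ] ≋ gen′ u) → subalgebra gen ≅ subalgebra gen′
    subalgebra≅subalgebra gen gen′ e e′ eq eq′ = record
      { to = λ x → sub (Sub.elt x) (Sub.expr x [ e ]) (rewitness (Sub.expr x) e gen′ eq (Sub.witness x))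
      ; from = λ x → sub (Sub.elt x) (Sub.expr x [ e′ ]) (rewitness (Sub.expr x) e′ gen eq′ (Sub.witness x))
      ; to-cong = λ p → p
      ; from-cong = λ p → p
      ; to-+ = λ _ _ → ≋-refl
      ; to-* = λ _ _ → ≋-refl
      ; to-ι = λ _ → ≋-refl
      ; to∘from = λ _ → ≋-refl
      ; from∘to = λ _ → ≋-refl
      }
      where
      rewitness : {U U′ : Set} (t : Term U) (e : U → Term U′) (gen′ : U′ → Term V) {gen : U → Term V} {x : Term V} →
                  (∀ u → e u [ gen′ ] ≋ gen u) → t [ gen ] ≋ x → t [ e ] [ gen′ ] ≋ x
      rewitness t e gen′ eq p = ≋-trans (≋-reflexive (substitute-substitute t e gen′))
        (≋-trans (substitute-pointwise rel t eq) p)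

    selected-sum : ∀ {k} {U : Set} (I : Fin k → Bool) (h : Fin k → U) (g : U → Term V) →
                   ⨁ (λ i → if I i then var (h i) else 𝟘) [ g ] ≋ lincomb (λ i → indicator (I i)) (λ i → g (h i))
    selected-sum I h g = ≋-trans (≋-reflexive (⨁-substitute (λ i → if I i then var (h i) else 𝟘) g)) (⨁-cong select)
      where
      select : ∀ i → (if I i then var (h i) else 𝟘) [ g ] ≋ con (indicator (I i)) ⊗ g (h i)
      select i with I i
      ... | true  = ≋-sym (⊗-idˡ _)
      ... | false = ≋-sym (⊗-zeroˡ _)

    ⨂-𝟙 : ∀ {k} {f : Fin k → Term V} → (∀ i → f i ≋ 𝟙) → ⨂ f ≋ 𝟙
    ⨂-𝟙 {zero}  p = ≋-refl
    ⨂-𝟙 {suc k} p = ≋-trans (⊗-cong (p zero) (⨂-𝟙 (λ i → p (suc i)))) (⊗-idˡ 𝟙)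

    ⨂-singleton : ∀ {k} (i : Fin k) (f : Fin k → Term V) → ⨂ (λ j → if does (i ≟ j) then f j else 𝟙) ≋ f i
    ⨂-singleton zero    f = ≋-trans (⊗-congˡ (⨂-𝟙 (λ _ → ≋-refl))) (⊗-idʳ (f zero))
    ⨂-singleton (suc i) f = ≋-trans (⊗-congˡ (⨂-singleton i (λ j → f (suc j)))) (⊗-idˡ (f (suc i)))

    -- This links the two kinds of relations, turning sums over I into products over I; a vertex
    -- outside I contributes exp 0 = 1.
    exp-selected-sum : ∀ {k} N (I : Fin k → Bool) (f g : Fin k → Term V) d → (∀ i → f i ^ d ≋ 𝟘) →
      suc (k ℕ.* d) ℕ.≤ 2 ℕ.+ N → (∀ i → exp N (f i) ≋ g i) →
      lincomb (λ i → indicator (I i)) f ^ suc (k ℕ.* d) ≋ 𝟘 ×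
      exp N (lincomb (λ i → indicator (I i)) f) ≋ ⨂ (λ i → if I i then g i else 𝟙)
    exp-selected-sum N I f g d f^d≋𝟘 bound exp-f
      with ExpLog.exp-⨁ rel N (λ i → con (indicator (I i)) ⊗ f i) d
             (λ i → ^-vanishes-⊗ d (⊗-comm _ (f i)) (f^d≋𝟘 i)) bound
    ... | nil , eq = nil , ≋-trans eq (⨂-cong select)
      where
      open ExpLog rel
      select : ∀ i → exp N (con (indicator (I i)) ⊗ f i) ≋ (if I i then g i else 𝟙)
      select i with I i
      ... | true  = ≋-trans (exp-cong N (⊗-idˡ (f i))) (exp-f i)
      ... | false = ≋-trans (exp-square-zero N (solve 1 (λ x → :0 :* x :* (:0 :* x) := :0) ≋-refl (f i)))
                            (≋-trans (⊕-congˡ (⊗-zeroˡ (f i))) (⊕-idʳ 𝟙))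

  count-cong : ∀ {m} {p q : Fin m → Bool} → (∀ e → p e ≡ q e) → count p ≡ count q
  count-cong {zero}  p≡q = ≡.refl
  count-cong {suc m} p≡q = ≡.cong₂ (λ b n → (if b then 1 else 0) ℕ.+ n) (p≡q zero) (count-cong (λ e → p≡q (suc e)))

  cut-complement : ∀ {k m} (s t : Fin m → Fin k) I → cut s t (λ v → not (I v)) ≡ cut s t I
  cut-complement s t I = count-cong (λ e → not-xor-not (I (s e)) (I (t e)))
    where
    not-xor-not : ∀ x y → not x xor not y ≡ x xor y
    not-xor-not true  true  = ≡.refl
    not-xor-not true  false = ≡.refl
    not-xor-not false true  = ≡.refl
    not-xor-not false false = ≡.refl

  empty-tabulate : ∀ {k} (I : Fin k → Bool) → ¬ Nonempty (tabulate I) → ∀ i → I i ≡ false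
  empty-tabulate I empty i with I i in eq
  ... | false = ≡.refl
  ... | true  = contradiction (i , lookup⇒[]= i (tabulate I) (≡.trans (lookup∘tabulate I i) eq)) empty

  -- Specialisation to a given graph

  module _ {n : ℕ} (G : Graph n) where
    open Graph G

    countEdges≡count : ∀ {k} (p : Fin k → Bool) → countEdges G p ≡ count p
    countEdges≡count {zero}  p = ≡.refl
    countEdges≡count {suc k} p = ≡.cong ((if p zero then 1 else 0) ℕ.+_) (countEdges≡count (λ e → p (suc e)))

    D≡cut : ∀ S I → (∀ v → lookup S v ≡ I v) → D G S ≡ cut src tgt I
    D≡cut S I eq = ≡.trans (countEdges≡count (λ e → lookup S (src e) xor lookup S (tgt e))) (count-cong (λ e → ≡.cong₂ _xor_ (eq (src e)) (eq (tgt e))))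

    src≢tgt : ∀ e → src e ≢ tgt e
    src≢tgt e = <⇒≢ (src<tgt e)

    coeff≈incidence : ∀ i e → coeff G i e ≈ incidence src tgt i e
    coeff≈incidence i e with i ≟ src e | i ≟ tgt e
    ... | yes ≡.refl | _ = 𝕂.trans
      (𝕂.sym 1-0≈1)
      (𝕂.reflexive (≡.sym (≡.cong₂ (λ x y → x + - y) (kronecker-refl i) (kronecker-≢ (λ eq → src≢tgt e (≡.sym eq))))))
    ... | no i≢s | yes ≡.refl = 𝕂.trans
      (𝕂.sym 0-1≈-1)
      (𝕂.reflexive (≡.sym (≡.cong₂ (λ x y → x + - y) (kronecker-≢ (src≢tgt e)) (kronecker-refl i))))
    ... | no i≢s | no i≢t = 𝕂.trans
      (𝕂.sym (𝕂.-‿inverseʳ 0#))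
      (𝕂.reflexive (≡.sym (≡.cong₂ (λ x y → x + - y) (kronecker-≢ (λ eq → i≢s (≡.sym eq))) (kronecker-≢ (λ eq → i≢t (≡.sym eq))))))

    -- One truncation for two kinds of sums: m square-zero edge terms require order 2m + 1, and n +
    -- 1 vertex terms with vanishing power m + 1 require (n+1)(m+1) + 1.
    N : ℕ
    N = m ℕ.* 2 ℕ.+ suc n ℕ.* suc m

    edge-bound : suc (m ℕ.* 2) ℕ.≤ 2 ℕ.+ N
    edge-bound = ℕ.s≤s (ℕ.m≤n⇒m≤1+n (ℕ.m≤m+n (m ℕ.* 2) (suc n ℕ.* suc m)))

    vertex-bound : suc (suc n ℕ.* suc m) ℕ.≤ 2 ℕ.+ N
    vertex-bound = ℕ.s≤s (ℕ.m≤n⇒m≤1+n (ℕ.m≤n+m (suc n ℕ.* suc m) (m ℕ.* 2)))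

    -- Identities for `X` and `Y` in the edge algebra

    module _ where
      open Alg (squares {m})
      open Linear (squares {m})
      open ExpLog (squares {m})

      X≋X′ : ∀ i → X G i ≋ X′ src tgt i
      X≋X′ i = lincomb-cong var (coeff≈incidence i)

      selected-X-nilpotent : ∀ I → lincomb (λ i → indicator (I i)) (X G) ^ suc (cut src tgt I) ≋ 𝟘
      selected-X-nilpotent I = ≋-trans (^-cong (suc (cut src tgt I))
        (≋-trans (⨁-cong (λ i → ⊗-congˡ {con (indicator (I i))} (X≋X′ i))) (≋-reflexive (≡.sym (linear-substitute (λ i → indicator (I i)) (X′ src tgt))))))
        (linear[X′]-^ src tgt I)

      -- Every edge enters the sum of all `X` once with 1 and once with -1.
      X₀ : X G zero ≋ ⊝ ⨁ (λ i → X G (suc i))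
      X₀ = ⊖≋𝟘⇒≋ (begin
        X G zero ⊖ (⊝ ⨁ (λ i → X G (suc i)))
          ≈⟨ solve 2 (λ x y → x :- (:- y) := :1 :* x :+ y) ≋-refl (X G zero) _ ⟩
        𝟙 ⊗ X G zero ⊕ ⨁ (λ i → X G (suc i))
          ≈⟨ ⊕-cong (⊗-congˡ (X≋X′ zero)) (⨁-cong (λ i → ≋-trans (X≋X′ (suc i)) (≋-sym (⊗-idˡ _)))) ⟩
        lincomb (λ _ → 1#) (X′ src tgt)
          ≡⟨ linear-substitute (λ _ → 1#) (X′ src tgt) ⟨
        linear (λ _ → 1#) [ X′ src tgt ]
          ≈⟨ linear[X′] src tgt squares (λ _ → 1#) ⟩
        linear (λ _ → 1# + - 1#)
          ≈⟨ lincomb-0 _ var (λ _ → 𝕂.-‿inverseʳ 1#) ⟩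
        𝟘 ∎)
        where open Relation.Binary.Reasoning.Setoid setoid

      X-nilpotent : ∀ i → X G i ^ suc m ≋ 𝟘
      X-nilpotent i = ^-vanishes-above (ℕ.s≤s (count≤ {m} (λ _ → true)))
        (sum-of-square-zero-^ squares _ (λ _ → true) (λ e → square-of-monomial _ e) (λ _ ()))

      exp-X : ∀ i → exp N (X G i) ≋ Y G i
      exp-X i = ≋-trans
        (proj₂ (exp-⨁ N (λ e → con (coeff G i e) ⊗ var e) 2
          (λ e → ≋-trans (⊗-congˡ (⊗-idʳ _)) (square-of-monomial (coeff G i e) e)) edge-bound))
        (⨂-cong (λ e → exp-square-zero N (square-of-monomial (coeff G i e) e)))

      B-rel[X]≋𝟘 : ∀ r → B-rel G r [ (λ i → X G (suc i)) ] ≋ 𝟘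
      B-rel[X]≋𝟘 (S , _) = ≋-trans (≋-reflexive (^-substitute L (suc d) _)) (≋-trans (^-cong (suc d) (≋-trans
          (selected-sum squares (lookup S) (λ i → i) (λ i → X G (suc i)))
          (solve 2 (λ x y → y := :0 :* x :+ y) ≋-refl (X G zero) _)))
        (≡.subst (λ e → lincomb (λ i → indicator (lookup (false ∷ S) i)) (X G) ^ suc e ≋ 𝟘)
          (≡.sym (D≡cut (false ∷ S) _ (λ _ → ≡.refl))) (selected-X-nilpotent (lookup (false ∷ S)))))
        where
        L = ⨁ (λ i → if lookup S i then var i else 𝟘)
        d = D G (false ∷ S)

      -- The product of the selected `Y` is the exponential of the sum of the corresponding `X`, and
      -- an exponential minus 1 is a multiple of its argument.
      D-rel[Y]≋𝟘 : ∀ r → D-rel G r [ Y G ] ≋ 𝟘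
      D-rel[Y]≋𝟘 (S , _) = ≋-trans (≋-reflexive (^-substitute (P ⊖ 𝟙) (suc (D G S)) (Y G)))
        (^-vanishes-⊗ (suc (D G S))
          (≋-trans (⊕-congʳ (≋-trans (≋-reflexive (⨂-substitute (λ i → if lookup S i then var i else 𝟙) (Y G))) (≋-trans (⨂-cong select) (≋-sym exp-sum))))
                   (exp-1-divisible N (lincomb (λ i → indicator (lookup S i)) (X G))))
          (≡.subst (λ e → lincomb (λ i → indicator (lookup S i)) (X G) ^ suc e ≋ 𝟘)
            (≡.sym (D≡cut S _ (λ _ → ≡.refl))) (selected-X-nilpotent (lookup S))))
        where
        P = ⨂ (λ i → if lookup S i then var i else 𝟙)
        exp-sum = proj₂ (exp-selected-sum squares N (lookup S) (X G) (Y G) (suc m) X-nilpotent vertex-bound exp-X)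
        select : ∀ i → (if lookup S i then var i else 𝟙) [ Y G ] ≋ (if lookup S i then Y G i else 𝟙)
        select i with lookup S i
        ... | true  = ≋-refl
        ... | false = ≋-refl

    -- The additive presentation

    module _ where
      open Alg (B-rel G)
      open Linear (B-rel G)

      -- In K[x₁,…,xₙ] the variable x₀ of the symmetric presentation J is minus the sum of the others.
      τ : Fin (suc n) → Term (Fin n)
      τ zero    = ⊝ ⨁ var
      τ (suc i) = var i

      selected-τ : (Fin (suc n) → Bool) → Term (Fin n)
      selected-τ I = lincomb (λ i → indicator (I i)) τ

      -- A nonempty I gives a relation of `B-G`; for the empty set the form itself is zero.
      selected-τ-nilpotent₀ : ∀ I → I zero ≡ false → selected-τ I ^ suc (cut src tgt I) ≋ 𝟘
      selected-τ-nilpotent₀ I I0 with nonempty? (tabulate (λ i → I (suc i)))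
      ... | yes S≢∅ = ≋-trans (^-cong (suc (cut src tgt I)) (≋-sym (begin
          ⨁ (λ i → if lookup S i then var i else 𝟘)
            ≡⟨ substitute-var _ ⟨
          ⨁ (λ i → if lookup S i then var i else 𝟘) [ var ]
            ≈⟨ selected-sum (B-rel G) (lookup S) (λ i → i) var ⟩
          linear (λ i → indicator (lookup S i))
            ≈⟨ solve 2 (λ x y → y := :0 :* x :+ y) ≋-refl (τ zero) _ ⟩
          lincomb (λ i → indicator (lookup (false ∷ S) i)) τ
            ≈⟨ lincomb-cong τ (λ i → 𝕂.reflexive (≡.cong indicator (lookup-S i))) ⟩
          selected-τ I ∎)))
        (≡.subst (λ d → ⨁ (λ i → if lookup S i then var i else 𝟘) ^ suc d ≋ 𝟘) (D≡cut (false ∷ S) I lookup-S) (relation (S , S≢∅)))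
        where
        open Relation.Binary.Reasoning.Setoid setoid
        S = tabulate (λ i → I (suc i))
        lookup-S : ∀ i → lookup (false ∷ S) i ≡ I i
        lookup-S zero    = ≡.sym I0
        lookup-S (suc i) = lookup∘tabulate (λ i → I (suc i)) i
      ... | no S≡∅ = ≋𝟘⇒⊗≋𝟘 _ (lincomb-0 _ τ (λ i → 𝕂.reflexive (≡.cong indicator (all-false i))))
        where
        all-false : ∀ i → I i ≡ false
        all-false zero    = I0
        all-false (suc i) = empty-tabulate (λ i → I (suc i)) S≡∅ i

      -- All `τ` sum to zero, so complementary sets have opposite forms. Together with
      -- `cut-complement` this reduces sets containing vertex 0 to sets avoiding it.
      selected-τ-complement : ∀ I → selected-τ I ≋ selected-τ (λ i → not (I i)) ⊗ con (- 1#)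
      selected-τ-complement I = begin
        selected-τ I
          ≈⟨ lincomb-cong τ (λ i → complement (I i)) ⟩
        lincomb (λ i → 1# + - 1# * indicator (not (I i))) τ
          ≈⟨ lincomb-+ (λ _ → 1#) (λ i → - 1# * indicator (not (I i))) τ ⟩
        lincomb (λ _ → 1#) τ ⊕ lincomb (λ i → - 1# * indicator (not (I i))) τ
          ≈⟨ ⊕-cong total (lincomb-* (- 1#) (λ i → indicator (not (I i))) τ) ⟩
        𝟘 ⊕ con (- 1#) ⊗ selected-τ (λ i → not (I i))
          ≈⟨ ≋-trans (⊕-idˡ _) (⊗-comm _ _) ⟩
        selected-τ (λ i → not (I i)) ⊗ con (- 1#) ∎
        where
        open Relation.Binary.Reasoning.Setoid setoid
        complement : ∀ b → indicator b ≈ 1# + - 1# * indicator (not b)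
        complement true  = x≈x+y0 1# (- 1#)
        complement false = 0≈1+[-1]1
        total : lincomb (λ _ → 1#) τ ≋ 𝟘
        total = ≋-trans (⊕-congˡ (⨁-cong (λ i → ⊗-idˡ (var i)))) (solve 1 (λ x → :1 :* (:- x) :+ x := :0) ≋-refl (⨁ var))

      J[τ]≋𝟘 : ∀ I → J src tgt I [ τ ] ≋ 𝟘
      J[τ]≋𝟘 I = ≋-trans (≋-reflexive (≡.trans (^-substitute (linear (λ i → indicator (I i))) (suc (cut src tgt I)) τ)
        (≡.cong (_^ suc (cut src tgt I)) (linear-substitute (λ i → indicator (I i)) τ)))) (nilpotent-τ (I zero) ≡.refl)
        where
        nilpotent-τ : ∀ b → I zero ≡ b → selected-τ I ^ suc (cut src tgt I) ≋ 𝟘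
        nilpotent-τ false I0 = selected-τ-nilpotent₀ I I0
        nilpotent-τ true  I0 = ^-vanishes-⊗ (suc (cut src tgt I)) (selected-τ-complement I)
          (≡.subst (λ d → selected-τ (λ i → not (I i)) ^ suc d ≋ 𝟘) (cut-complement src tgt I)
            (selected-τ-nilpotent₀ (λ i → not (I i)) (≡.cong not I0)))

      -- `τ` retracts onto the polynomials in x_1, ..., x_n, so `p` may be viewed among all vertex
      -- variables and brought back unchanged.
      B-kernel : ∀ p → Presentation._≋_ squares (p [ (λ i → X G (suc i)) ]) 𝟘 → p ≋ 𝟘
      B-kernel p p[X]≋𝟘 = begin
        p                                     ≡⟨ substitute-var p ⟨
        p [ var ]                             ≡⟨ substitute-substitute p (λ i → var (suc i)) τ ⟨
        p [ (λ i → var (suc i)) ] [ τ ]       ≈⟨ substitute-cong (B-rel G) (J src tgt) τ J[τ]≋𝟘 (X′-kernel m src tgt (p [ (λ i → var (suc i)) ]) p[X′]≋𝟘) ⟩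
        𝟘                                     ∎
        where
        open Relation.Binary.Reasoning.Setoid setoid
        p[X′]≋𝟘 : Presentation._≋_ squares (p [ (λ i → var (suc i)) ] [ X′ src tgt ]) 𝟘
        p[X′]≋𝟘 = Presentation.≋-trans (Alg.≋-reflexive squares (substitute-substitute p (λ i → var (suc i)) (X′ src tgt)))
          (Presentation.≋-trans (substitute-pointwise squares p (λ i → Presentation.≋-sym (X≋X′ (suc i)))) p[X]≋𝟘)

    -- The multiplicative presentation

    module _ where
      open Alg (D-rel G)
      open ExpLog (D-rel G)

      D-relation : ∀ I → (⨂ (λ i → if I i then var i else 𝟙) ⊖ 𝟙) ^ suc (cut src tgt I) ≋ 𝟘
      D-relation I with nonempty? (tabulate I)
      ... | yes S≢∅ = ≋-trans
        (^-cong (suc (cut src tgt I)) (⊕-congʳ (⨂-cong (λ i → ≋-reflexive (≡.cong (if_then var i else 𝟙) (≡.sym (lookup∘tabulate I i)))))))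
        (≡.subst (λ d → (⨂ (λ i → if lookup (tabulate I) i then var i else 𝟙) ⊖ 𝟙) ^ suc d ≋ 𝟘)
          (D≡cut (tabulate I) I (lookup∘tabulate I)) (relation (tabulate I , S≢∅)))
      ... | no S≡∅ = ≋𝟘⇒⊗≋𝟘 _ (≋⇒⊖≋𝟘 (⨂-𝟙 (D-rel G)
        (λ i → ≋-reflexive (≡.cong (if_then var i else 𝟙) (empty-tabulate I S≡∅ i)))))

      y-1-nilpotent : ∀ i → (var i ⊖ 𝟙) ^ suc m ≋ 𝟘
      y-1-nilpotent i = ^-vanishes-above (ℕ.s≤s (count≤ _))
        (≋-trans (^-cong (suc (cut src tgt (λ j → does (i ≟ j)))) (⊕-congʳ (≋-sym (⨂-singleton (D-rel G) i var))))
          (D-relation (λ j → does (i ≟ j))))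

      log-y : Fin (suc n) → Term (Fin (suc n))
      log-y i = log N (suc m) (var i ⊖ 𝟙)

      exp-log-y : ∀ i → exp N (log-y i) ≋ var i
      exp-log-y i = ≋-trans (exp-log N (suc m) (y-1-nilpotent i)) (solve 1 (λ y → :1 :+ (y :- :1) := y) ≋-refl (var i))

      -- The exponential of the sum of `log-y` over I is the product of the y_i, whose relation in
      -- `D-G` has the right exponent; `^-vanishes-exp` hands it to the sum.
      J[log-y]≋𝟘 : ∀ I → J src tgt I [ log-y ] ≋ 𝟘
      J[log-y]≋𝟘 I = ≋-trans (≋-reflexive (≡.trans (^-substitute (linear (λ i → indicator (I i))) (suc (cut src tgt I)) log-y)
          (≡.cong (_^ suc (cut src tgt I)) (linear-substitute (λ i → indicator (I i)) log-y))))
        (^-vanishes-exp N (suc (suc n ℕ.* suc m)) (suc (cut src tgt I)) (proj₁ exp-sum)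
          (≋-trans (^-cong (suc (cut src tgt I)) (⊕-congʳ (proj₂ exp-sum))) (D-relation I)))
        where
        exp-sum = exp-selected-sum (D-rel G) N I log-y var (suc m)
          (λ i → ^-vanishes-⊗ (suc m) (proj₂ (log-divisible N (suc m) (var i ⊖ 𝟙))) (y-1-nilpotent i))
          vertex-bound exp-log-y

      -- Under y_i = exp x_i the polynomial `p` becomes one that vanishes at the `X′`, hence lies in
      -- the ideal of `J`; substituting `log-y` for the x_i then recovers `p`.
      D-kernel : ∀ p → Presentation._≋_ squares (p [ Y G ]) 𝟘 → p ≋ 𝟘
      D-kernel p p[Y]≋𝟘 = begin
        p                                       ≡⟨ substitute-var p ⟨
        p [ var ]                               ≈⟨ substitute-pointwise (D-rel G) p (λ i → ≋-trans (≋-reflexive (exp-substitute N (var i) log-y)) (exp-log-y i)) ⟨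
        p [ (λ i → exp N (var i) [ log-y ]) ]   ≡⟨ substitute-substitute p (λ i → exp N (var i)) log-y ⟨
        p [ (λ i → exp N (var i)) ] [ log-y ]   ≈⟨ substitute-cong (D-rel G) (J src tgt) log-y J[log-y]≋𝟘 (X′-kernel m src tgt (p [ (λ i → exp N (var i)) ]) p[exp-X′]≋𝟘) ⟩
        𝟘                                       ∎
        where
        open Relation.Binary.Reasoning.Setoid setoid
        p[exp-X′]≋𝟘 : Presentation._≋_ squares (p [ (λ i → exp N (var i)) ] [ X′ src tgt ]) 𝟘
        p[exp-X′]≋𝟘 = Presentation.≋-trans (Alg.≋-reflexive squares (substitute-substitute p (λ i → exp N (var i)) (X′ src tgt)))
          (Presentation.≋-trans (substitute-pointwise squares p (λ i → Presentation.≋-trans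
            (Alg.≋-reflexive squares (exp-substitute N (var i) (X′ src tgt)))
            (Presentation.≋-trans (ExpLog.exp-cong squares N (Presentation.≋-sym (X≋X′ i))) (exp-X i)))) p[Y]≋𝟘)

    -- The isomorphisms

    B≅C : B-G G ≅ C-G G
    B≅C = presentation≅subalgebra squares (B-rel G) (λ i → X G (suc i)) B-rel[X]≋𝟘 B-kernel

    D≅K : D-G G ≅ K-G G
    D≅K = presentation≅subalgebra squares (D-rel G) (Y G) D-rel[Y]≋𝟘 D-kernel

    -- Both are the same subalgebra: X_i is the logarithm of Y_i and Y_i the exponential of X_i,
    -- where X_0 is expressed through the other X_i by `τ`.
    C≅K : C-G G ≅ K-G G
    C≅K = subalgebra≅subalgebra squares (λ i → X G (suc i)) (Y G) (λ i → log N (suc m) (var (suc i) ⊖ 𝟙)) (λ i → exp N (τ i)) log-Y exp-τ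
      where
      open Alg (squares {m})
      open ExpLog (squares {m})
      log-Y : ∀ i → log N (suc m) (var (suc i) ⊖ 𝟙) [ Y G ] ≋ X G (suc i)
      log-Y i = ≋-trans (≋-reflexive (log-substitute N (suc m) (var (suc i) ⊖ 𝟙) (Y G)))
        (≋-trans (log-cong N (suc m) (⊕-congʳ (≋-sym (exp-X (suc i))))) (log-exp N (suc m) (X-nilpotent (suc i))))
      τ[X] : ∀ i → τ i [ (λ i → X G (suc i)) ] ≋ X G i
      τ[X] zero    = ≋-trans (⊝-cong (≋-reflexive (⨁-substitute var _))) (≋-sym X₀)
      τ[X] (suc i) = ≋-refl
      exp-τ : ∀ i → exp N (τ i) [ (λ i → X G (suc i)) ] ≋ Y G i
      exp-τ i = ≋-trans (≋-reflexive (exp-substitute N (τ i) _)) (≋-trans (exp-cong N (τ[X] i)) (exp-X i))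

    all-isomorphic : (B-G G ≅ C-G G) × (B-G G ≅ D-G G) × (B-G G ≅ K-G G) ×
                     (C-G G ≅ D-G G) × (C-G G ≅ K-G G) × (D-G G ≅ K-G G)
    all-isomorphic = B≅C , ≅-trans lawful-B lawful-D B≅K K≅D , B≅K , ≅-trans lawful-C lawful-D C≅K K≅D , C≅K , D≅K
      where
      lawful-B = presentation-lawful (B-rel G)
      lawful-C = subalgebra-lawful squares (λ i → X G (suc i))
      lawful-D = presentation-lawful (D-rel G)
      lawful-K = subalgebra-lawful squares (Y G)
      B≅K = ≅-trans lawful-B lawful-K B≅C C≅K
      K≅D = ≅-sym lawful-D lawful-K D≅K

theorem2 : {c ℓ : Level} (K : CommutativeRing c ℓ) → IsFieldOfChar0 K →
    (n : ℕ) (G : Graph n) →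
    let open Algebras K in
    (B-G G ≅ C-G G) × (B-G G ≅ D-G G) × (B-G G ≅ K-G G) ×
    (C-G G ≅ D-G G) × (C-G G ≅ K-G G) × (D-G G ≅ K-G G)
theorem2 K isField n G = Isomorphisms.all-isomorphic K isField G
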